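{- As formal power series in $q$ (equivalently, for complex $q$ with $|q|<1$), $$\sum_{n\ge 0}\frac{q^{2n^2+2n}}{(q;q)_{2n+1}}=\frac{1}{(q;q)_\infty}\sum_{k\in\mathbb{Z}}\left(q^{12k^2+5k}-q^{12k^2-13k+3}\right).$$
   Context: $(q;q)_n=\prod_{j=1}^{n}(1-q^j)$ and $(q;q)_\infty=\prod_{j\ge1}(1-q^j)$. -}

module Defs where

open import Data.Nat.Base as ℕ using (ℕ; zero; suc; z≤n; s≤s; z<s)
import Data.Nat.Properties as ℕ
open import Data.Integer.Base as ℤ using (ℤ; +_; -[1+_]; 0ℤ; 1ℤ; +≤+; +<+)
import Data.Integer.Properties as ℤ
open import Data.Integer.Tactic.RingSolver using (solve-∀)
open import Data.Fin.Base using (Fin; zero; suc; toℕ)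
import Data.Fin.Properties as Fin
open import Data.Product.Base using (∃; _×_; _,_; proj₁; proj₂)
open import Data.Vec.Base using (Vec; []; _∷_; head; lookup)
open import Function.Base using (_∘_)
open import Relation.Nullary.Decidable.Core using (yes; no)
open import Relation.Nullary.Negation.Core using (contradiction)
open import Relation.Binary.PropositionalEquality
  using (_≡_; refl; sym; trans; cong; cong₂; subst; module ≡-Reasoning)
open import Algebra.Properties.CommutativeMonoid.Sum ℤ.+-0-commutativeMonoid
  using (sum; sum⁺-syntax; sum-cong-≗; sum-replicate-zero)

------------------------------------------------------------------------
-- Formal power series in q over ℤ; f n is the coefficient of q^n.

Series : Set
Series = ℕ → ℤ

infix  4 _≈_
infixl 6 _+_ _-_
infixl 7 _*_ _/_
infix  8 _⁻¹
infix  9 q^_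

_≈_ : Series → Series → Set
f ≈ g = ∀ n → f n ≡ g n

0# : Series
0# _ = 0ℤ

-- Exponents are integers so that exponents such as 12k² - 13k + 3 can be
-- written as they stand.  A negative exponent would give the zero series;
-- e₁-bound and e₂-bound below show that none occurs.
q^_ : ℤ → Series
(q^ e) n with e ℤ.≟ + n
... | yes _ = 1ℤ
... | no  _ = 0ℤ

1# : Series
1# = q^ (+ 0)

_+_ _-_ _*_ : Series → Series → Series
(f + g) n = f n ℤ.+ g n
(f - g) n = f n ℤ.- g n
(f * g) n = ∑[ i ≤ n ] (f (toℕ i) ℤ.* g (n ℕ.∸ toℕ i))

-- The multiplicative inverse of a series with constant term 1 (*-inverseʳ).
-- inverseCoeffs f n lists the coefficients of q^n, …, q^1, q^0 of f ⁻¹, the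
-- next one being determined by the vanishing of a coefficient of f * f ⁻¹.
inverseCoeffs : Series → (n : ℕ) → Vec ℤ (suc n)
inverseCoeffs f zero    = 1ℤ ∷ []
inverseCoeffs f (suc n) =
  (ℤ.- (∑[ i ≤ n ] (f (suc (toℕ i)) ℤ.* lookup (inverseCoeffs f n) i)))
    ∷ inverseCoeffs f n

_⁻¹ : Series → Series
(f ⁻¹) n = head (inverseCoeffs f n)

_/_ : Series → Series → Series
f / g = f * g ⁻¹

------------------------------------------------------------------------
-- Limits in the q-adic topology: each coefficient is eventually constant.

Convergent : (ℕ → Series) → Set
Convergent F = ∀ m → ∃ λ N → ∀ n → N ℕ.≤ n → F n m ≡ F N m

lim : (F : ℕ → Series) → Convergent F → Series
lim F c m = F (proj₁ (c m)) m

partialSum : (ℕ → Series) → ℕ → Series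
partialSum F zero    = 0#
partialSum F (suc n) = partialSum F n + F n

Summable : (ℕ → Series) → Set
Summable F = Convergent (partialSum F)

Σℕ : (F : ℕ → Series) → Summable F → Series
Σℕ F c = lim (partialSum F) c

-- The two halves k ≥ 0 and k < 0 are required to converge separately.
Summableℤ : (ℤ → Series) → Set
Summableℤ F = Summable (F ∘ +_) × Summable (F ∘ -[1+_])

Σℤ : (F : ℤ → Series) → Summableℤ F → Series
Σℤ F (c⁺ , c⁻) = Σℕ (F ∘ +_) c⁺ + Σℕ (F ∘ -[1+_]) c⁻

-- qPoch n is (q;q)_n; its limit qPoch∞ below is (q;q)_∞.
qPoch : ℕ → Series
qPoch zero    = 1#
qPoch (suc n) = qPoch n * (1# - q^ (+ suc n))

private
  sum-zero : ∀ {n} {t : Fin n → ℤ} → (∀ i → t i ≡ 0ℤ) → sum t ≡ 0ℤ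
  sum-zero {n} t≡0 = trans (sum-cong-≗ t≡0) (sum-replicate-zero n)

  lookup-inverseCoeffs : ∀ f n (i : Fin (suc n)) →
    lookup (inverseCoeffs f n) i ≡ (f ⁻¹) (n ℕ.∸ toℕ i)
  lookup-inverseCoeffs f zero    zero    = refl
  lookup-inverseCoeffs f (suc n) zero    = refl
  lookup-inverseCoeffs f (suc n) (suc i) = lookup-inverseCoeffs f n i

*-inverseʳ : ∀ f → f 0 ≡ 1ℤ → f * f ⁻¹ ≈ 1#
*-inverseʳ f f₀≡1 zero rewrite f₀≡1 = refl
*-inverseʳ f f₀≡1 (suc n) = begin
  f 0 ℤ.* (ℤ.- s) ℤ.+ t  ≡⟨ cong₂ ℤ._+_ (cong (ℤ._* (ℤ.- s)) f₀≡1) t≡s ⟩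
  1ℤ ℤ.* (ℤ.- s) ℤ.+ s   ≡⟨ cong (ℤ._+ s) (ℤ.*-identityˡ (ℤ.- s)) ⟩
  ℤ.- s ℤ.+ s            ≡⟨ ℤ.+-inverseˡ s ⟩
  0ℤ                     ∎
  where
  open ≡-Reasoning
  s t : ℤ
  s = ∑[ i ≤ n ] (f (suc (toℕ i)) ℤ.* lookup (inverseCoeffs f n) i)
  t = ∑[ i ≤ n ] (f (suc (toℕ i)) ℤ.* (f ⁻¹) (n ℕ.∸ toℕ i))
  t≡s : t ≡ s
  t≡s = sum-cong-≗ {suc n} λ i →
    cong (f (suc (toℕ i)) ℤ.*_) (sym (lookup-inverseCoeffs f n i))

q^-below : ∀ {e m} → + m ℤ.< e → (q^ e) m ≡ 0ℤ
q^-below {e} {m} m<e with e ℤ.≟ + m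
... | yes e≡m = contradiction (sym e≡m) (ℤ.<⇒≢ m<e)
... | no  _   = refl

q^*-below : ∀ {e m} g → + m ℤ.< e → (q^ e * g) m ≡ 0ℤ
q^*-below {e} {m} g m<e = sum-zero {suc m} λ i →
  cong (ℤ._* g (m ℕ.∸ toℕ i))
    (q^-below (ℤ.≤-<-trans (+≤+ (Fin.toℕ≤pred[n] i)) m<e))

*-1-q^-below : ∀ {e m} f → + m ℤ.< e → (f * (1# - q^ e)) m ≡ f m
*-1-q^-below {e} {m} f m<e = go m f below
  where
  below : ∀ j → j ℕ.≤ m → (1# - q^ e) j ≡ 1# j
  below j j≤m = trans
    (cong (λ x → 1# j ℤ.- x) (q^-below (ℤ.≤-<-trans (+≤+ j≤m) m<e)))
    (ℤ.+-identityʳ (1# j))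
  go : ∀ m f → (∀ j → j ℕ.≤ m → (1# - q^ e) j ≡ 1# j) →
       (f * (1# - q^ e)) m ≡ f m
  go zero f h = trans (ℤ.+-identityʳ _)
    (trans (cong (f 0 ℤ.*_) (h 0 z≤n)) (ℤ.*-identityʳ (f 0)))
  go (suc m) f h = trans
    (cong₂ ℤ._+_
      (trans (cong (f 0 ℤ.*_) (h (suc m) ℕ.≤-refl)) (ℤ.*-zeroʳ (f 0)))
      (go m (f ∘ suc) λ j j≤m → h j (ℕ.m≤n⇒m≤1+n j≤m)))
    (ℤ.+-identityˡ (f (suc m)))

stable⇒convergent : ∀ {F} (N : ℕ → ℕ) →
  (∀ m n → N m ℕ.≤ n → F (suc n) m ≡ F n m) → Convergent F
stable⇒convergent {F} N stable m = N m , λ n N≤n →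
  subst (λ k → F k m ≡ F (N m) m) (ℕ.m∸n+n≡m N≤n) (go (n ℕ.∸ N m))
  where
  go : ∀ d → F (d ℕ.+ N m) m ≡ F (N m) m
  go zero    = refl
  go (suc d) = trans (stable m (d ℕ.+ N m) (ℕ.m≤n+m (N m) d)) (go d)

order⇒summable : ∀ {F} → (∀ n m → m ℕ.< n → F n m ≡ 0ℤ) → Summable F
order⇒summable {F} order = stable⇒convergent suc λ m n m<n → trans
  (cong (λ x → partialSum F n m ℤ.+ x) (order n m m<n))
  (ℤ.+-identityʳ (partialSum F n m))

lim-irrelevant : ∀ {F} (c c′ : Convergent F) → lim F c ≈ lim F c′
lim-irrelevant {F} c c′ m = trans
  (sym (proj₂ (c m) _ (ℕ.m≤m⊔n (proj₁ (c m)) (proj₁ (c′ m)))))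
  (proj₂ (c′ m) _ (ℕ.m≤n⊔m (proj₁ (c m)) (proj₁ (c′ m))))

qPoch-convergent : Convergent qPoch
qPoch-convergent = stable⇒convergent (λ m → m) λ m n m≤n →
  *-1-q^-below (qPoch n) (+<+ (s≤s m≤n))

qPoch∞ : Series
qPoch∞ = lim qPoch qPoch-convergent

qPoch-constant : ∀ n → qPoch n 0 ≡ 1ℤ
qPoch-constant zero    = refl
qPoch-constant (suc n) =
  trans (*-1-q^-below {+ suc n} {0} (qPoch n) (+<+ z<s)) (qPoch-constant n)

qPoch-inverse : ∀ n → qPoch n * qPoch n ⁻¹ ≈ 1#
qPoch-inverse n = *-inverseʳ (qPoch n) (qPoch-constant n)

qPoch∞-inverse : qPoch∞ * qPoch∞ ⁻¹ ≈ 1#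
qPoch∞-inverse = *-inverseʳ qPoch∞ refl

lhsTerm : ℕ → Series
lhsTerm n = q^ (+ (2 ℕ.* n ℕ.^ 2 ℕ.+ 2 ℕ.* n)) / qPoch (2 ℕ.* n ℕ.+ 1)

e₁ e₂ : ℤ → ℤ
e₁ k = + 12 ℤ.* k ℤ.^ 2 ℤ.+ + 5 ℤ.* k
e₂ k = + 12 ℤ.* k ℤ.^ 2 ℤ.- + 13 ℤ.* k ℤ.+ + 3

rhsTerm : ℤ → Series
rhsTerm k = q^ (e₁ k) - q^ (e₂ k)

private
  poly≥0 : ∀ a b c n →
    0ℤ ℤ.≤ + a ℤ.* (+ n ℤ.* + n) ℤ.+ + b ℤ.* + n ℤ.+ + c
  poly≥0 a b c n
    rewrite sym (ℤ.pos-* n n) | sym (ℤ.pos-* a (n ℕ.* n)) | sym (ℤ.pos-* b n)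
    = +≤+ z≤n

  bound : ∀ {x e r} → e ≡ x ℤ.+ r → 0ℤ ℤ.≤ r → x ℤ.≤ e
  bound {x} {r = r} refl 0≤r =
    subst (ℤ._≤ x ℤ.+ r) (ℤ.+-identityʳ x) (ℤ.+-monoʳ-≤ x 0≤r)

  e₁⁺ : ∀ x → + 12 ℤ.* (x ℤ.* (x ℤ.* 1ℤ)) ℤ.+ + 5 ℤ.* x
    ≡ x ℤ.+ (+ 12 ℤ.* (x ℤ.* x) ℤ.+ + 4 ℤ.* x ℤ.+ + 0)
  e₁⁺ = solve-∀

  e₁⁻ : ∀ x → let y = ℤ.- (1ℤ ℤ.+ x) in
    + 12 ℤ.* (y ℤ.* (y ℤ.* 1ℤ)) ℤ.+ + 5 ℤ.* y
    ≡ (1ℤ ℤ.+ x) ℤ.+ (+ 12 ℤ.* (x ℤ.* x) ℤ.+ + 18 ℤ.* x ℤ.+ + 6)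
  e₁⁻ = solve-∀

  e₂⁺ : ∀ x → let y = 1ℤ ℤ.+ x in
    + 12 ℤ.* (y ℤ.* (y ℤ.* 1ℤ)) ℤ.- + 13 ℤ.* y ℤ.+ + 3
    ≡ (1ℤ ℤ.+ x) ℤ.+ (+ 12 ℤ.* (x ℤ.* x) ℤ.+ + 10 ℤ.* x ℤ.+ + 1)
  e₂⁺ = solve-∀

  e₂⁻ : ∀ x → let y = ℤ.- (1ℤ ℤ.+ x) in
    + 12 ℤ.* (y ℤ.* (y ℤ.* 1ℤ)) ℤ.- + 13 ℤ.* y ℤ.+ + 3
    ≡ (1ℤ ℤ.+ x) ℤ.+ (+ 12 ℤ.* (x ℤ.* x) ℤ.+ + 36 ℤ.* x ℤ.+ + 27)
  e₂⁻ = solve-∀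

  -- k is kept abstract here, and the case splits below go through ℤ-cases
  -- and ℕ-cases, because normalising e₁ or e₂ at + suc n is very slow.
  e₁-bound⁺ : ∀ x →
    0ℤ ℤ.≤ + 12 ℤ.* (x ℤ.* x) ℤ.+ + 4 ℤ.* x ℤ.+ + 0 → x ℤ.≤ e₁ x
  e₁-bound⁺ x = bound (e₁⁺ x)

  e₁-bound⁻ : ∀ x k → k ≡ ℤ.- (1ℤ ℤ.+ x) →
    0ℤ ℤ.≤ + 12 ℤ.* (x ℤ.* x) ℤ.+ + 18 ℤ.* x ℤ.+ + 6 → 1ℤ ℤ.+ x ℤ.≤ e₁ k
  e₁-bound⁻ x k k≡ = bound (trans (cong e₁ k≡) (e₁⁻ x))

  e₂-bound⁺ : ∀ x k → k ≡ 1ℤ ℤ.+ x →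
    0ℤ ℤ.≤ + 12 ℤ.* (x ℤ.* x) ℤ.+ + 10 ℤ.* x ℤ.+ + 1 → 1ℤ ℤ.+ x ℤ.≤ e₂ k
  e₂-bound⁺ x k k≡ = bound (trans (cong e₂ k≡) (e₂⁺ x))

  e₂-bound⁻ : ∀ x k → k ≡ ℤ.- (1ℤ ℤ.+ x) →
    0ℤ ℤ.≤ + 12 ℤ.* (x ℤ.* x) ℤ.+ + 36 ℤ.* x ℤ.+ + 27 → 1ℤ ℤ.+ x ℤ.≤ e₂ k
  e₂-bound⁻ x k k≡ = bound (trans (cong e₂ k≡) (e₂⁻ x))

  ℤ-cases : (P : ℤ → Set) → (∀ n → P (+ n)) → (∀ n → P -[1+ n ]) → ∀ k → P k
  ℤ-cases P p⁺ p⁻ (+ n)    = p⁺ n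
  ℤ-cases P p⁺ p⁻ -[1+ n ] = p⁻ n

  ℕ-cases : (P : ℕ → Set) → P 0 → (∀ n → P (suc n)) → ∀ n → P n
  ℕ-cases P p₀ p⁺ zero    = p₀
  ℕ-cases P p₀ p⁺ (suc n) = p⁺ n

e₁-bound : ∀ k → + ℤ.∣ k ∣ ℤ.≤ e₁ k
e₁-bound = ℤ-cases (λ k → + ℤ.∣ k ∣ ℤ.≤ e₁ k)
  (λ n → e₁-bound⁺ (+ n) (poly≥0 12 4 0 n))
  (λ n → e₁-bound⁻ (+ n) -[1+ n ] refl (poly≥0 12 18 6 n))

e₂-bound : ∀ k → + ℤ.∣ k ∣ ℤ.≤ e₂ k
e₂-bound = ℤ-cases (λ k → + ℤ.∣ k ∣ ℤ.≤ e₂ k)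
  (ℕ-cases (λ n → + n ℤ.≤ e₂ (+ n)) (+≤+ z≤n)
    (λ n → e₂-bound⁺ (+ n) (+ suc n) refl (poly≥0 12 10 1 n)))
  (λ n → e₂-bound⁻ (+ n) -[1+ n ] refl (poly≥0 12 36 27 n))

lhsTerm-summable : Summable lhsTerm
lhsTerm-summable = order⇒summable λ n m m<n →
  q^*-below (qPoch (2 ℕ.* n ℕ.+ 1) ⁻¹)
    (+<+ (ℕ.<-≤-trans m<n
      (ℕ.≤-trans (ℕ.m≤m+n n _) (ℕ.m≤n+m (2 ℕ.* n) (2 ℕ.* n ℕ.^ 2)))))

rhsTerm-summable : Summableℤ rhsTerm
rhsTerm-summable =
    order⇒summable (λ n m m<n → below (+ n) m<n)
  , order⇒summable (λ n m m<n → below -[1+ n ] (ℕ.m<n⇒m<1+n m<n))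
  where
  below : ∀ k {m} → m ℕ.< ℤ.∣ k ∣ → rhsTerm k m ≡ 0ℤ
  below k m<k = cong₂ ℤ._-_
    (q^-below (ℤ.<-≤-trans (+<+ m<k) (e₁-bound k)))
    (q^-below (ℤ.<-≤-trans (+<+ m<k) (e₂-bound k)))

{-# OPTIONS --safe #-}

-- Put x = √q.  Since 2n² + 2n = ((2n+1)² - 1)/2, the left-hand side times -x
-- is the odd part in x of Σₘ (-1)ᵐ x^(m²) / (x²; x²)ₘ, which is (x; x²)_∞ by
-- Euler's identity.  Multiplying by (q; q)_∞ = (x²; x²)_∞ gives (x; x)_∞, and
-- the odd part of the pentagonal number series is -x times the sum over k.
--
-- Both identities are proved modulo a power of x, with finite sums.  For
-- Gⱼ = Σₘ (-1)ᵐ x^(m² + 2jm) / (x²; x²)ₘ one has Gⱼ = (1 - x^(2j+1)) Gⱼ₊₁ and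
-- Gⱼ → 1.  For the pentagonal number theorem, Shanks' identity
--   Σ_{k≤n} (-1)ᵏ (x; x)ₙ / (x; x)ₖ x^(kn + k(k+1)/2)
--     = 1 + Σ_{1≤k≤n} (-1)ᵏ (x^(k(3k-1)/2) + x^(k(3k+1)/2))
-- has the left-hand side congruent to (x; x)ₙ modulo xⁿ.
module Submission where

open import Algebra.Bundles using (CommutativeRing)
open import Data.Nat.Base as ℕ using (ℕ; zero; suc; z≤n; s≤s)
import Data.Nat.Properties as ℕ
import Data.Nat.Tactic.RingSolver as ℕ-Solver
open import Data.Integer.Base as ℤ using (ℤ; +_; -[1+_]; 0ℤ; 1ℤ; +<+)
import Data.Integer.Properties as ℤ
import Data.Integer.Tactic.RingSolver as ℤ-Solver
open import Data.Product.Base using (∃; _,_; proj₁; proj₂)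
open import Data.Sign.Base as Sign using ()
open import Function.Base using (_∘_)
open import Relation.Nullary.Decidable using (Dec; yes; no; dec⇒maybe)
open import Relation.Nullary.Negation using (contradiction)
open import Relation.Binary.PropositionalEquality as ≡ using (_≡_; _≢_; cong; cong₂)

-- A ring solver with integer coefficients for an arbitrary commutative ring.

module IntegerCoefficients {c ℓ} (R : CommutativeRing c ℓ) where

  open import Algebra.Solver.Ring.AlmostCommutativeRing
    using (fromCommutativeRing; _-Raw-AlmostCommutative⟶_)
  open import Data.Maybe.Base using (Maybe; map)
  open CommutativeRing R
  open import Algebra.Properties.Ring ring
  open import Algebra.Properties.AbelianGroup +-abelianGroup using (⁻¹-∙-comm)
  open import Algebra.Properties.Semiring.Mult.TCOptimised semiring
    using (_×_; 1+×; ×-homo-+; ×1-homo-*)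
  open import Relation.Binary.Reasoning.Setoid setoid

  private
    -- With this `_×_`, `0 × 1#` and `1 × 1#` compute to `0#` and `1#`, so `con (+ 0)` and
    -- `con (+ 1)` stand for the ring constants definitionally.
    ⟦_⟧ : ℤ → Carrier
    ⟦ + n ⟧      = n × 1#
    ⟦ -[1+ n ] ⟧ = - (suc n × 1#)

    cancel : ∀ a b d → (a + b) - (a + d) ≈ b - d
    cancel a b d = begin
      (a + b) - (a + d)      ≈⟨ +-cong (+-comm a b) (sym (⁻¹-∙-comm a d)) ⟩
      (b + a) + (- a - d)    ≈⟨ +-assoc b a _ ⟩
      b + (a + (- a - d))    ≈⟨ +-congˡ (+-assoc a (- a) _) ⟨
      b + ((a - a) - d)      ≈⟨ +-congˡ (+-congʳ (-‿inverseʳ a)) ⟩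
      b + (0# - d)           ≈⟨ +-congˡ (+-identityˡ _) ⟩
      b - d                  ∎

    ⊖-homo : ∀ m n → ⟦ m ℤ.⊖ n ⟧ ≈ m × 1# - n × 1#
    ⊖-homo m       zero    = sym (trans (+-congˡ -0#≈0#) (+-identityʳ _))
    ⊖-homo zero    (suc n) = sym (+-identityˡ _)
    ⊖-homo (suc m) (suc n) = begin
      ⟦ suc m ℤ.⊖ suc n ⟧              ≡⟨ cong ⟦_⟧ (ℤ.[1+m]⊖[1+n]≡m⊖n m n) ⟩
      ⟦ m ℤ.⊖ n ⟧                      ≈⟨ ⊖-homo m n ⟩
      m × 1# - n × 1#                  ≈⟨ cancel 1# _ _ ⟨
      (1# + m × 1#) - (1# + n × 1#)    ≈⟨ +-cong (1+× m 1#) (-‿cong (1+× n 1#)) ⟨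
      suc m × 1# - suc n × 1#          ∎

    +-homo : ∀ i j → ⟦ i ℤ.+ j ⟧ ≈ ⟦ i ⟧ + ⟦ j ⟧
    +-homo (+ m)    (+ n)    = ×-homo-+ 1# m n
    +-homo (+ m)    -[1+ n ] = ⊖-homo m (suc n)
    +-homo -[1+ m ] (+ n)    = trans (⊖-homo n (suc m)) (+-comm _ _)
    +-homo -[1+ m ] -[1+ n ] = begin
      - (suc (suc (m ℕ.+ n)) × 1#)     ≡⟨ cong (λ k → - (suc k × 1#)) (ℕ.+-suc m n) ⟨
      - ((suc m ℕ.+ suc n) × 1#)       ≈⟨ -‿cong (×-homo-+ 1# (suc m) (suc n)) ⟩
      - (suc m × 1# + suc n × 1#)      ≈⟨ ⁻¹-∙-comm _ _ ⟨
      - (suc m × 1#) - (suc n × 1#)    ∎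

    -‿homo : ∀ i → ⟦ ℤ.- i ⟧ ≈ - ⟦ i ⟧
    -‿homo (+ zero)  = sym -0#≈0#
    -‿homo (+ suc n) = refl
    -‿homo -[1+ n ]  = sym (-‿involutive _)

    -◃-homo : ∀ n → ⟦ Sign.- ℤ.◃ n ⟧ ≈ - (n × 1#)
    -◃-homo zero    = sym -0#≈0#
    -◃-homo (suc n) = refl

    +◃-homo : ∀ n → ⟦ Sign.+ ℤ.◃ n ⟧ ≈ n × 1#
    +◃-homo zero    = refl
    +◃-homo (suc n) = refl

    *-homo : ∀ i j → ⟦ i ℤ.* j ⟧ ≈ ⟦ i ⟧ * ⟦ j ⟧
    *-homo (+ m) (+ n) = trans (+◃-homo (m ℕ.* n)) (×1-homo-* m n)
    *-homo (+ m) -[1+ n ] = begin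
      ⟦ Sign.- ℤ.◃ m ℕ.* suc n ⟧     ≈⟨ -◃-homo (m ℕ.* suc n) ⟩
      - ((m ℕ.* suc n) × 1#)         ≈⟨ -‿cong (×1-homo-* m (suc n)) ⟩
      - (m × 1# * suc n × 1#)        ≈⟨ -‿distribʳ-* _ _ ⟩
      m × 1# * - (suc n × 1#)        ∎
    *-homo -[1+ m ] (+ n) = begin
      ⟦ Sign.- ℤ.◃ suc m ℕ.* n ⟧     ≈⟨ -◃-homo (suc m ℕ.* n) ⟩
      - ((suc m ℕ.* n) × 1#)         ≈⟨ -‿cong (×1-homo-* (suc m) n) ⟩
      - (suc m × 1# * n × 1#)        ≈⟨ -‿distribˡ-* _ _ ⟩
      - (suc m × 1#) * n × 1#        ∎
    *-homo -[1+ m ] -[1+ n ] = begin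
      (suc m ℕ.* suc n) × 1#             ≈⟨ ×1-homo-* (suc m) (suc n) ⟩
      suc m × 1# * suc n × 1#            ≈⟨ -‿involutive _ ⟨
      - - (suc m × 1# * suc n × 1#)      ≈⟨ -‿cong (-‿distribʳ-* _ _) ⟩
      - (suc m × 1# * - (suc n × 1#))    ≈⟨ -‿distribˡ-* _ _ ⟩
      - (suc m × 1#) * - (suc n × 1#)    ∎

    homomorphism : ℤ.+-*-rawRing -Raw-AlmostCommutative⟶ fromCommutativeRing R
    homomorphism = record
      { ⟦_⟧    = ⟦_⟧
      ; +-homo = +-homo
      ; *-homo = *-homo
      ; -‿homo = -‿homo
      ; 0-homo = refl
      ; 1-homo = refl
      }

    -- Equality in R need not be decidable, as for power series. Comparing coefficients in ℤ is what
    -- lets the solver recognise cancellations.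
    _coeff≟_ : ∀ i j → Maybe (⟦ i ⟧ ≈ ⟦ j ⟧)
    i coeff≟ j = map (λ i≡j → reflexive (cong ⟦_⟧ i≡j)) (dec⇒maybe (i ℤ.≟ j))

  open import Algebra.Solver.Ring ℤ.+-*-rawRing (fromCommutativeRing R)
    homomorphism _coeff≟_ public
    using (solve; con; _:+_; _:*_; _:-_; :-_; _:=_)

-- Congruences modulo a ring element.

module Congruence {c ℓ} (R : CommutativeRing c ℓ) where

  open CommutativeRing R
  open IntegerCoefficients R
  open import Relation.Binary.Reasoning.Setoid setoid

  infix 4 _≈_[mod_]

  -- An explicit cofactor replaces q-adic approximation, so that the argument runs in any
  -- commutative ring, without a topology.
  _≈_[mod_] : Carrier → Carrier → Carrier → Set _
  a ≈ b [mod d ] = ∃ λ h → a ≈ b + d * h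

  ≈⇒mod : ∀ {a b d} → a ≈ b → a ≈ b [mod d ]
  ≈⇒mod {b = b} {d} a≈b =
    0# , trans a≈b (solve 2 (λ b d → b := b :+ d :* con (+ 0)) refl b d)

  mod-trans : ∀ {a b e d} → a ≈ b [mod d ] → b ≈ e [mod d ] → a ≈ e [mod d ]
  mod-trans {a} {b} {e} {d} (h , a≈) (k , b≈) = h + k , (begin
    a                    ≈⟨ a≈ ⟩
    b + d * h            ≈⟨ +-congʳ b≈ ⟩
    e + d * k + d * h    ≈⟨ solve 4 (λ e d k h →
                              e :+ d :* k :+ d :* h := e :+ d :* (h :+ k))
                              refl e d k h ⟩
    e + d * (h + k)      ∎)

  mod-sym : ∀ {a b d} → a ≈ b [mod d ] → b ≈ a [mod d ]
  mod-sym {a} {b} {d} (h , a≈) = - h , (begin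
    b                        ≈⟨ solve 3 (λ b d h →
                                  b := b :+ d :* h :+ d :* (:- h)) refl b d h ⟩
    b + d * h + d * (- h)    ≈⟨ +-congʳ a≈ ⟨
    a + d * (- h)            ∎)

  mod-+ : ∀ {a a′ b b′ d} → a ≈ a′ [mod d ] → b ≈ b′ [mod d ] →
          a + b ≈ a′ + b′ [mod d ]
  mod-+ {a} {a′} {b} {b′} {d} (h , a≈) (k , b≈) = h + k , (begin
    a + b                          ≈⟨ +-cong a≈ b≈ ⟩
    (a′ + d * h) + (b′ + d * k)    ≈⟨ solve 5 (λ a b d h k →
                                        (a :+ d :* h) :+ (b :+ d :* k)
                                        := a :+ b :+ d :* (h :+ k))
                                        refl a′ b′ d h k ⟩
    a′ + b′ + d * (h + k)          ∎)

  mod-*ˡ : ∀ {a b d} e → a ≈ b [mod d ] → e * a ≈ e * b [mod d ]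
  mod-*ˡ {a} {b} {d} e (h , a≈) = e * h , (begin
    e * a                ≈⟨ *-congˡ a≈ ⟩
    e * (b + d * h)      ≈⟨ solve 4 (λ e b d h →
                              e :* (b :+ d :* h) := e :* b :+ d :* (e :* h))
                              refl e b d h ⟩
    e * b + d * (e * h)  ∎)

  mod-*ʳ : ∀ {a b d} e → a ≈ b [mod d ] → a * e ≈ b * e [mod d ]
  mod-*ʳ e a≈b = mod-trans (≈⇒mod (*-comm _ e))
    (mod-trans (mod-*ˡ e a≈b) (≈⇒mod (*-comm e _)))

  mod-factor : ∀ {a b d} d′ → a ≈ b [mod d * d′ ] → a ≈ b [mod d ]
  mod-factor d′ (h , a≈) = d′ * h , trans a≈ (+-congˡ (*-assoc _ d′ h))

  mod-cong : ∀ {a b d d′} → d ≈ d′ → a ≈ b [mod d ] → a ≈ b [mod d′ ]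
  mod-cong d≈d′ (h , a≈) = h , trans a≈ (+-congˡ (*-congʳ d≈d′))

-- Finite sums and q-factorials in a commutative ring.

module QSeries {c ℓ} (R : CommutativeRing c ℓ) where

  open CommutativeRing R
  open import Algebra.Properties.Semiring.Exp semiring using (_^_)

  Σ< : (ℕ → Carrier) → ℕ → Carrier
  Σ< f zero    = 0#
  Σ< f (suc n) = Σ< f n + f n

  poch : Carrier → ℕ → Carrier
  poch x zero    = 1#
  poch x (suc n) = poch x n * (1# - x ^ suc n)

  -- The ring has no division, so reciprocals of q-factorials are supplied as a sequence.
  PochInverse : Carrier → (ℕ → Carrier) → Set _
  PochInverse x I = ∀ n → poch x n * I n ≈ 1#

  sgn : ℕ → Carrier
  sgn zero    = 1#
  sgn (suc n) = - sgn n

-- Euler's identity and the pentagonal number theorem modulo powers of x.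

module EulerShanks {c ℓ} (R : CommutativeRing c ℓ)
  (x : CommutativeRing.Carrier R) (I : ℕ → CommutativeRing.Carrier R)
  (poch*I : QSeries.PochInverse R (CommutativeRing._*_ R x x) I) where

  open CommutativeRing R
  open QSeries R
  open IntegerCoefficients R
  open Congruence R
  open import Algebra.Properties.Semiring.Exp semiring
    using (_^_; ^-homo-*; ^-congʳ)
  open import Algebra.Properties.CommutativeSemiring.Exp commutativeSemiring
    using (^-distrib-*)
  open import Relation.Binary.Reasoning.Setoid setoid

  y : Carrier
  y = x * x

  -- Multiply `J n` by `poch z (suc n) * J (suc n)`, which is 1, and cancel `poch z n * J n`.
  inverse-suc : ∀ z (J : ℕ → Carrier) → PochInverse z J →
                ∀ n → J n ≈ J (suc n) * (1# - z ^ suc n)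
  inverse-suc z J inv n = begin
    J n                                        ≈⟨ *-identityʳ _ ⟨
    J n * 1#                                   ≈⟨ *-congˡ (inv (suc n)) ⟨
    J n * (poch z n * u * J (suc n))
      ≈⟨ solve 4 (λ j p u j′ → j :* (p :* u :* j′) := p :* j :* (j′ :* u))
           refl (J n) (poch z n) u (J (suc n)) ⟩
    poch z n * J n * (J (suc n) * u)           ≈⟨ *-congʳ (inv n) ⟩
    1# * (J (suc n) * u)                       ≈⟨ *-identityˡ _ ⟩
    J (suc n) * u                              ∎
    where u = 1# - z ^ suc n

  inverse-zero : ∀ z (J : ℕ → Carrier) → PochInverse z J → J 0 ≈ 1#
  inverse-zero z J inv = trans (sym (*-identityˡ (J 0))) (inv 0)

  -- a j m = (-1)ᵐ x^(m² + 2jm)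
  a : ℕ → ℕ → Carrier
  a j zero    = 1#
  a j (suc m) = - (a j m * (x * y ^ m * y ^ j))

  t G : ℕ → ℕ → Carrier
  t j m = a j m * I m
  G j = Σ< (t j)

  a-shift : ∀ j m → a (suc j) m ≈ a j m * y ^ m
  a-shift j zero    = sym (*-identityʳ 1#)
  a-shift j (suc m) = begin
    - (a (suc j) m * (x * y ^ m * (y * y ^ j)))
      ≈⟨ -‿cong (*-congʳ (a-shift j m)) ⟩
    - (a j m * y ^ m * (x * y ^ m * (y * y ^ j)))
      ≈⟨ solve 5 (λ A Y x y J →
           :- (A :* Y :* (x :* Y :* (y :* J)))
           := :- (A :* (x :* Y :* J)) :* (y :* Y))
           refl (a j m) (y ^ m) x y (y ^ j) ⟩
    - (a j m * (x * y ^ m * y ^ j)) * (y * y ^ m)    ∎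

  -- Split 1 = y^(m+1) + (1 - y^(m+1)). The first part raises j by `a-shift`; in the second, 1 -
  -- y^(m+1) cancels the last factor of the denominator and lowers m.
  t-suc : ∀ j m → t j (suc m) ≈ t (suc j) (suc m) - x * y ^ j * t (suc j) m
  t-suc j m = begin
    - (a j m * (x * y ^ m * y ^ j)) * I (suc m)
      ≈⟨ solve 6 (λ A Y x y J I →
           :- (A :* (x :* Y :* J)) :* I
           := :- (A :* (x :* Y :* J)) :* (y :* Y) :* I
              :- x :* J :* (A :* Y :* (I :* (con (+ 1) :- y :* Y))))
           refl (a j m) (y ^ m) x y (y ^ j) (I (suc m)) ⟩
    a j (suc m) * y ^ suc m * I (suc m)
      - x * y ^ j * (a j m * y ^ m * (I (suc m) * (1# - y ^ suc m)))
      ≈⟨ +-cong (*-congʳ (a-shift j (suc m)))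
           (-‿cong (*-congˡ (*-cong (a-shift j m) (inverse-suc y I poch*I m)))) ⟨
    t (suc j) (suc m) - x * y ^ j * t (suc j) m    ∎

  G-suc : ∀ j M → G j (suc M) ≈ G (suc j) (suc M) - x * y ^ j * G (suc j) M
  G-suc j zero    = solve 3 (λ I x J →
    con (+ 0) :+ con (+ 1) :* I
    := con (+ 0) :+ con (+ 1) :* I :- x :* J :* con (+ 0))
    refl (I 0) x (y ^ j)
  G-suc j (suc M) = trans (+-cong (G-suc j M) (t-suc j M))
    (solve 5 (λ g₁ t₁ u g₀ t₀ →
      g₁ :- u :* g₀ :+ (t₁ :- u :* t₀) := g₁ :+ t₁ :- u :* (g₀ :+ t₀))
      refl (G (suc j) (suc M)) (t (suc j) (suc M)) (x * y ^ j)
        (G (suc j) M) (t (suc j) M))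

  -- Each step of the recursion supplies a factor x. The true exponent m² + 2jm is at least m, and m
  -- is enough to discard a last term in `G-step`.
  x^∣a : ∀ j m → ∃ λ h → a j m ≈ x ^ m * h
  x^∣a j zero    = 1# , sym (*-identityʳ 1#)
  x^∣a j (suc m) with h , a≈ ← x^∣a j m = - (h * (y ^ m * y ^ j)) , (begin
    - (a j m * (x * y ^ m * y ^ j))
      ≈⟨ -‿cong (*-congʳ a≈) ⟩
    - (x ^ m * h * (x * y ^ m * y ^ j))
      ≈⟨ solve 5 (λ X h x Y J →
           :- (X :* h :* (x :* Y :* J)) := x :* X :* (:- (h :* (Y :* J))))
           refl (x ^ m) h x (y ^ m) (y ^ j) ⟩
    x * x ^ m * - (h * (y ^ m * y ^ j))    ∎)

  -- The second sum in `G-suc` is one term short. Completing it costs x y^j times `t (suc j) M`,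
  -- which is divisible by x^(M+1).
  G-step : ∀ j M →
    G j (suc M) ≈ (1# - x * y ^ j) * G (suc j) (suc M) [mod x ^ suc M ]
  G-step j M with h , a≈ ← x^∣a (suc j) M = y ^ j * h * I M , (begin
    G j (suc M)
      ≈⟨ G-suc j M ⟩
    g + t (suc j) M - x * y ^ j * g
      ≈⟨ solve 4 (λ g t x J →
           g :+ t :- x :* J :* g
           := (con (+ 1) :- x :* J) :* (g :+ t) :+ x :* J :* t)
           refl g (t (suc j) M) x (y ^ j) ⟩
    (1# - x * y ^ j) * (g + t (suc j) M) + x * y ^ j * (a (suc j) M * I M)
      ≈⟨ +-congˡ (*-congˡ (*-congʳ a≈)) ⟩
    (1# - x * y ^ j) * (g + t (suc j) M) + x * y ^ j * (x ^ M * h * I M)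
      ≈⟨ +-congˡ (solve 5 (λ x J X h I →
           x :* J :* (X :* h :* I) := x :* X :* (J :* h :* I))
           refl x (y ^ j) (x ^ M) h (I M)) ⟩
    (1# - x * y ^ j) * (g + t (suc j) M) + x * x ^ M * (y ^ j * h * I M)    ∎)
    where g = G (suc j) M

  -- oddPoch n = (x; x²)ₙ
  oddPoch : ℕ → Carrier
  oddPoch zero    = 1#
  oddPoch (suc j) = oddPoch j * (1# - x * y ^ j)

  G-iterate : ∀ j M → G 0 (suc M) ≈ oddPoch j * G j (suc M) [mod x ^ suc M ]
  G-iterate zero    M = ≈⇒mod (sym (*-identityˡ _))
  G-iterate (suc j) M = mod-trans (G-iterate j M)
    (mod-trans (mod-*ˡ (oddPoch j) (G-step j M)) (≈⇒mod (sym (*-assoc _ _ _))))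

  y^≈x^*x^ : ∀ n → y ^ n ≈ x ^ n * x ^ n
  y^≈x^*x^ = ^-distrib-* x x

  -- Every term with m ≥ 1 contains y^j, hence x^j; only the term m = 0 survives.
  G-limit : ∀ j M → G j (suc M) ≈ 1# [mod x ^ j ]
  G-limit j zero    = ≈⇒mod (begin
    0# + 1# * I 0    ≈⟨ trans (+-identityˡ _) (*-identityˡ _) ⟩
    I 0              ≈⟨ inverse-zero y I poch*I ⟩
    1#               ∎)
  G-limit j (suc M) = mod-trans (mod-+ (G-limit j M) t≈0) (≈⇒mod (+-identityʳ 1#))
    where
    t≈0 : t j (suc M) ≈ 0# [mod x ^ j ]
    t≈0 = _ , (begin
      - (a j M * (x * y ^ M * y ^ j)) * I (suc M)
        ≈⟨ *-congʳ (-‿cong (*-congˡ (*-congˡ (y^≈x^*x^ j)))) ⟩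
      - (a j M * (x * y ^ M * (x ^ j * x ^ j))) * I (suc M)
        ≈⟨ solve 5 (λ A x Y X I →
             :- (A :* (x :* Y :* (X :* X))) :* I
             := con (+ 0) :+ X :* (:- (A :* (x :* Y :* X)) :* I))
             refl (a j M) x (y ^ M) (x ^ j) (I (suc M)) ⟩
      0# + x ^ j * (- (a j M * (x * y ^ M * x ^ j)) * I (suc M))    ∎)

  -- Taking j = M + 1 makes the modulus of `G-limit` agree with the truncation modulus of
  -- `G-iterate`.
  euler : ∀ M → G 0 (suc M) ≈ oddPoch (suc M) [mod x ^ suc M ]
  euler M = mod-trans (G-iterate (suc M) M)
    (mod-trans (mod-*ˡ (oddPoch (suc M)) (G-limit (suc M) M))
      (≈⇒mod (*-identityʳ _)))

  y^≈x^2 : ∀ n → y ^ n ≈ x ^ (n ℕ.* 2)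
  y^≈x^2 zero    = refl
  y^≈x^2 (suc n) = trans (*-congˡ (y^≈x^2 n)) (*-assoc x x _)

  -- These are the odd and the even factors of (x; x)₂ₙ. The index is `n ℕ.* 2` because
  -- `suc n ℕ.* 2` computes to two successors, one for each new factor.
  oddPoch*poch : ∀ n → oddPoch n * poch y n ≈ poch x (n ℕ.* 2)
  oddPoch*poch zero    = *-identityʳ 1#
  oddPoch*poch (suc n) = begin
    oddPoch n * (1# - x * y ^ n) * (poch y n * (1# - x * x * y ^ n))
      ≈⟨ solve 4 (λ o p x Y →
           o :* (con (+ 1) :- x :* Y) :* (p :* (con (+ 1) :- x :* x :* Y))
           := o :* p :* (con (+ 1) :- x :* Y) :* (con (+ 1) :- x :* (x :* Y)))
           refl (oddPoch n) (poch y n) x (y ^ n) ⟩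
    oddPoch n * poch y n * (1# - x * y ^ n) * (1# - x * (x * y ^ n))
      ≈⟨ *-cong (*-cong (oddPoch*poch n)
           (+-congˡ (-‿cong (*-congˡ (y^≈x^2 n)))))
           (+-congˡ (-‿cong (*-congˡ (*-congˡ (y^≈x^2 n))))) ⟩
    poch x (suc n ℕ.* 2)    ∎

  -- The pentagonal number theorem by Shanks' identity.

  -- plusPoch n = (-x; x)ₙ
  plusPoch : ℕ → Carrier
  plusPoch zero    = 1#
  plusPoch (suc n) = plusPoch n * (1# + x ^ suc n)

  poch*plusPoch : ∀ n → poch x n * plusPoch n ≈ poch y n
  poch*plusPoch zero    = *-identityʳ 1#
  poch*plusPoch (suc n) = begin
    poch x n * (1# - X) * (plusPoch n * (1# + X))
      ≈⟨ solve 3 (λ p r X →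
           p :* (con (+ 1) :- X) :* (r :* (con (+ 1) :+ X))
           := p :* r :* (con (+ 1) :- X :* X))
           refl (poch x n) (plusPoch n) X ⟩
    poch x n * plusPoch n * (1# - X * X)
      ≈⟨ *-cong (poch*plusPoch n) (+-congˡ (-‿cong (sym (y^≈x^*x^ (suc n))))) ⟩
    poch y n * (1# - y ^ suc n)    ∎
    where X = x ^ suc n

  -- The hypothesis inverts only (x²; x²)ₙ = (x; x)ₙ (-x; x)ₙ; moving the second factor to the other
  -- side inverts (x; x)ₙ.
  J : ℕ → Carrier
  J n = plusPoch n * I n

  poch*J : PochInverse x J
  poch*J n = begin
    poch x n * (plusPoch n * I n)    ≈⟨ *-assoc _ _ _ ⟨
    poch x n * plusPoch n * I n      ≈⟨ *-congʳ (poch*plusPoch n) ⟩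
    poch y n * I n                   ≈⟨ poch*I n ⟩
    1#                               ∎

  -- b k n = (-1)ᵏ x^(kn + k(k+1)/2)
  b : ℕ → ℕ → Carrier
  b zero    n = 1#
  b (suc k) n = - (b k n * (x * (x ^ n * x ^ k)))

  b-shift : ∀ k n → b k (suc n) ≈ b k n * x ^ k
  b-shift zero    n = sym (*-identityʳ 1#)
  b-shift (suc k) n = trans (-‿cong (*-congʳ (b-shift k n)))
    (solve 4 (λ B K x N →
      :- (B :* K :* (x :* (x :* N :* K))) := :- (B :* (x :* (N :* K))) :* (x :* K))
      refl (b k n) (x ^ k) x (x ^ n))

  s : ℕ → ℕ → Carrier
  s n k = poch x n * J k * b k n

  -- Telescoping in K: the extra term is the boundary correction between the partial sums for n + 1
  -- and for n, and both sides grow by `s n (suc K)` when K is raised.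
  shanks-step : ∀ n K →
    Σ< (s (suc n)) K + poch x n * J K * b K (suc n) ≈ Σ< (s n) (suc K)
  shanks-step n zero    = refl
  shanks-step n (suc K) = begin
    S + s (suc n) K + p * J′ * b (suc K) (suc n)
      ≈⟨ +-cong (+-congˡ (*-cong (*-congˡ J≈) (b-shift K n)))
           (*-congˡ (-‿cong (*-congʳ (b-shift K n)))) ⟩
    S + p * (1# - x * N) * (J′ * (1# - x * X)) * (B * X)
      + p * J′ * - (B * X * (x * (x * N * X)))
      ≈⟨ solve 7 (λ S p x N J X B →
           S :+ p :* (con (+ 1) :- x :* N) :* (J :* (con (+ 1) :- x :* X)) :* (B :* X)
             :+ p :* J :* (:- (B :* X :* (x :* (x :* N :* X))))
           := S :+ p :* (J :* (con (+ 1) :- x :* X)) :* (B :* X)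
             :+ p :* J :* (:- (B :* (x :* (N :* X)))))
           refl S p x N J′ X B ⟩
    S + p * (J′ * (1# - x * X)) * (B * X) + s n (suc K)
      ≈⟨ +-congʳ (+-congˡ (*-cong (*-congˡ J≈) (b-shift K n))) ⟨
    S + p * J K * b K (suc n) + s n (suc K)
      ≈⟨ +-congʳ (shanks-step n K) ⟩
    Σ< (s n) (suc (suc K))    ∎
    where
    S = Σ< (s (suc n)) K
    p = poch x n
    J′ = J (suc K)
    N = x ^ n
    X = x ^ K
    B = b K n
    J≈ = inverse-suc x J poch*J K

  -- For k = n + 1 the two summands are (-1)ᵏ x^(k(3k-1)/2) and (-1)ᵏ x^(k(3k+1)/2).
  pent : ℕ → Carrier
  pent = Σ< λ n → b (suc n) n + b (suc n) (suc n)

  -- In passing to n + 1, the factor 1 - x^(n+1) of the term k = n is split. The 1 completes the sum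
  -- for n by `shanks-step`, and -x^(n+1) yields `b (suc n) n`. The term k = n + 1 is
  -- `b (suc n) (suc n)`, as its quotient of factorials is 1.
  shanks : ∀ n → Σ< (s n) (suc n) ≈ 1# + pent n
  shanks zero    = trans (+-identityˡ _)
    (trans (*-identityʳ _) (trans (poch*J 0) (sym (+-identityʳ 1#))))
  shanks (suc n) = begin
    S + p * (1# - x * N) * J n * b n (suc n) + p′ * J (suc n) * B₂
      ≈⟨ solve 8 (λ S p x N J B p′J B₂ →
           S :+ p :* (con (+ 1) :- x :* N) :* J :* B :+ p′J :* B₂
           := S :+ p :* J :* B :- x :* N :* (p :* J :* B) :+ p′J :* B₂)
           refl S p x N (J n) (b n (suc n)) (p′ * J (suc n)) B₂ ⟩
    S + p * J n * b n (suc n) - x * N * (p * J n * b n (suc n)) + p′ * J (suc n) * B₂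
      ≈⟨ +-cong (+-cong (trans (shanks-step n n) (shanks n))
           (-‿cong (*-congˡ (*-cong (poch*J n) (b-shift n n)))))
           (*-congʳ (poch*J (suc n))) ⟩
    1# + pent n - x * N * (1# * (b n n * N)) + 1# * B₂
      ≈⟨ solve 5 (λ P x N B B₂ →
           con (+ 1) :+ P :- x :* N :* (con (+ 1) :* (B :* N)) :+ con (+ 1) :* B₂
           := con (+ 1) :+ (P :+ (:- (B :* (x :* (N :* N))) :+ B₂)))
           refl (pent n) x N (b n n) B₂ ⟩
    1# + (pent n + (b (suc n) n + B₂))    ∎
    where
    S = Σ< (s (suc n)) n
    p = poch x n
    p′ = poch x (suc n)
    N = x ^ n
    B₂ = b (suc n) (suc n)

  -- Every term with k ≥ 1 contains x^(kn), and the term k = 0 is (x; x)ₙ.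
  shanks-limit : ∀ n K → Σ< (s n) (suc K) ≈ poch x n [mod x ^ n ]
  shanks-limit n zero    = ≈⇒mod (begin
    0# + poch x n * J 0 * 1#    ≈⟨ trans (+-identityˡ _) (*-identityʳ _) ⟩
    poch x n * J 0              ≈⟨ *-congˡ (inverse-zero x J poch*J) ⟩
    poch x n * 1#               ≈⟨ *-identityʳ _ ⟩
    poch x n                    ∎)
  shanks-limit n (suc K) = mod-trans (mod-+ (shanks-limit n K) s≈0)
    (≈⇒mod (+-identityʳ _))
    where
    s≈0 : s n (suc K) ≈ 0# [mod x ^ n ]
    s≈0 = _ , solve 6 (λ p J B x N K →
      p :* J :* (:- (B :* (x :* (N :* K))))
      := con (+ 0) :+ N :* (p :* J :* (:- (B :* (x :* K)))))
      refl (poch x n) (J (suc K)) (b K n) x (x ^ n) (x ^ K)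

  pentagonal : ∀ n → poch x n ≈ 1# + pent n [mod x ^ n ]
  pentagonal n = mod-trans (mod-sym (shanks-limit n n)) (≈⇒mod (shanks n))

  euler-pentagonal : ∀ n → let M = suc n in
    G 0 M * poch y M ≈ 1# + pent (M ℕ.* 2) [mod x ^ M ]
  euler-pentagonal n = mod-trans (mod-*ʳ (poch y M) (euler n))
    (mod-trans (≈⇒mod (oddPoch*poch M))
      -- The pentagonal congruence holds modulo x^(2M); it is weakened to the precision x^M of
      -- Euler's identity.
      (mod-factor (x ^ M) (mod-cong x^2M (pentagonal (M ℕ.* 2)))))
    where
    M = suc n
    x^2M : x ^ (M ℕ.* 2) ≈ x ^ M * x ^ M
    x^2M = trans (sym (y^≈x^2 M)) (y^≈x^*x^ M)

  -- The exponents in closed form.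

  x^[2*] : ∀ e → x ^ (2 ℕ.* e) ≈ y ^ e
  x^[2*] e = trans (^-congʳ x (ℕ.*-comm 2 e)) (sym (y^≈x^2 e))

  a-closed : ∀ m → a 0 m ≈ sgn m * x ^ (m ℕ.* m)
  a-closed zero    = sym (*-identityʳ 1#)
  a-closed (suc m) = begin
    - (a 0 m * (x * y ^ m * 1#))
      ≈⟨ -‿cong (*-cong (a-closed m) (*-congʳ (*-congˡ (sym (x^[2*] m))))) ⟩
    - (sgn m * x ^ (m ℕ.* m) * (x * x ^ (2 ℕ.* m) * 1#))
      ≈⟨ solve 4 (λ σ X x Y →
           :- (σ :* X :* (x :* Y :* con (+ 1))) := :- σ :* (x :* (X :* Y)))
           refl (sgn m) (x ^ (m ℕ.* m)) x (x ^ (2 ℕ.* m)) ⟩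
    - sgn m * (x * (x ^ (m ℕ.* m) * x ^ (2 ℕ.* m)))
      ≈⟨ *-congˡ (*-congˡ (^-homo-* x (m ℕ.* m) (2 ℕ.* m))) ⟨
    - sgn m * x ^ suc (m ℕ.* m ℕ.+ 2 ℕ.* m)
      ≈⟨ *-congˡ (^-congʳ x (square-suc m)) ⟩
    - sgn m * x ^ (suc m ℕ.* suc m)    ∎
    where
    square-suc : ∀ m → suc (m ℕ.* m ℕ.+ 2 ℕ.* m) ≡ suc m ℕ.* suc m
    square-suc = ℕ-Solver.solve-∀

  private
    exponent : ℕ → ℕ → ℕ
    exponent zero    n = 0
    exponent (suc k) n = suc (exponent k n ℕ.+ (n ℕ.+ k))

    2*exponent : ∀ k n → 2 ℕ.* exponent k n ≡ k ℕ.* (2 ℕ.* n ℕ.+ suc k)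
    2*exponent zero    n = ≡.refl
    2*exponent (suc k) n = ≡.trans (expand (exponent k n) n k)
      (≡.trans (cong (ℕ._+ 2 ℕ.* suc (n ℕ.+ k)) (2*exponent k n)) (collect n k))
      where
      expand : ∀ e n k →
        2 ℕ.* suc (e ℕ.+ (n ℕ.+ k)) ≡ 2 ℕ.* e ℕ.+ 2 ℕ.* suc (n ℕ.+ k)
      expand = ℕ-Solver.solve-∀
      collect : ∀ n k → k ℕ.* (2 ℕ.* n ℕ.+ suc k) ℕ.+ 2 ℕ.* suc (n ℕ.+ k)
        ≡ suc k ℕ.* (2 ℕ.* n ℕ.+ suc (suc k))
      collect = ℕ-Solver.solve-∀

    b-exponent : ∀ k n → b k n ≈ sgn k * x ^ exponent k n
    b-exponent zero    n = sym (*-identityʳ 1#)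
    b-exponent (suc k) n = begin
      - (b k n * (x * (x ^ n * x ^ k)))
        ≈⟨ -‿cong (*-cong (b-exponent k n) (*-congˡ (sym (^-homo-* x n k)))) ⟩
      - (sgn k * X * (x * Z))
        ≈⟨ solve 4 (λ σ X x Z →
             :- (σ :* X :* (x :* Z)) := :- σ :* (x :* (X :* Z))) refl (sgn k) X x Z ⟩
      - sgn k * (x * (X * Z))
        ≈⟨ *-congˡ (*-congˡ (^-homo-* x (exponent k n) (n ℕ.+ k))) ⟨
      - sgn k * x ^ exponent (suc k) n    ∎
      where
      X = x ^ exponent k n
      Z = x ^ (n ℕ.+ k)

  -- The exponent kn + k(k+1)/2 is pinned down by its double, which avoids division; the premise is
  -- then a polynomial identity.
  b-closed : ∀ k n e → 2 ℕ.* e ≡ k ℕ.* (2 ℕ.* n ℕ.+ suc k) →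
             b k n ≈ sgn k * x ^ e
  b-closed k n e 2e≡ = trans (b-exponent k n) (*-congˡ (^-congʳ x
    (ℕ.*-cancelˡ-≡ (exponent k n) e 2 (≡.trans (2*exponent k n) (≡.sym 2e≡)))))

-- The ring R[√q], in which (u , v) stands for u + v √q.
module AdjoinSqrt {c ℓ} (R : CommutativeRing c ℓ) (q : CommutativeRing.Carrier R) where

  open import Data.Product.Base using (_×_)
  open CommutativeRing R
  open IntegerCoefficients R

  adjoinSqrt : CommutativeRing c ℓ
  adjoinSqrt = record
    { Carrier = Carrier × Carrier
    ; _≈_     = λ (u , v) (u′ , v′) → u ≈ u′ × v ≈ v′
    ; _+_     = λ (u , v) (u′ , v′) → u + u′ , v + v′
    ; _*_     = λ (u , v) (u′ , v′) → u * u′ + q * (v * v′) , u * v′ + v * u′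
    ; -_      = λ (u , v) → - u , - v
    ; 0#      = 0# , 0#
    ; 1#      = 1# , 0#
    ; isCommutativeRing = record
      { isRing = record
        { +-isAbelianGroup = record
          { isGroup = record
            { isMonoid = record
              { isSemigroup = record
                { isMagma = record
                  { isEquivalence = record
                    { refl  = refl , refl
                    ; sym   = λ (p , r) → sym p , sym r
                    ; trans = λ (p , r) (p′ , r′) → trans p p′ , trans r r′
                    }
                  ; ∙-cong = λ (p , r) (p′ , r′) → +-cong p p′ , +-cong r r′
                  }
                ; assoc = λ _ _ _ → +-assoc _ _ _ , +-assoc _ _ _
                }
              ; identity = (λ _ → +-identityˡ _ , +-identityˡ _)
                         , (λ _ → +-identityʳ _ , +-identityʳ _)
              }
            ; inverse = (λ _ → -‿inverseˡ _ , -‿inverseˡ _)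
                      , (λ _ → -‿inverseʳ _ , -‿inverseʳ _)
            ; ⁻¹-cong = λ (p , r) → -‿cong p , -‿cong r
            }
          ; comm = λ _ _ → +-comm _ _ , +-comm _ _
          }
        ; *-cong = λ (p , r) (p′ , r′) →
              +-cong (*-cong p p′) (*-congˡ (*-cong r r′))
            , +-cong (*-cong p r′) (*-cong r p′)
        ; *-assoc = λ (u , v) (u′ , v′) (u″ , v″) →
              solve 7 (λ q u v u′ v′ u″ v″ →
                (u :* u′ :+ q :* (v :* v′)) :* u″ :+ q :* ((u :* v′ :+ v :* u′) :* v″)
                := u :* (u′ :* u″ :+ q :* (v′ :* v″)) :+ q :* (v :* (u′ :* v″ :+ v′ :* u″)))
                refl q u v u′ v′ u″ v″
            , solve 7 (λ q u v u′ v′ u″ v″ →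
                (u :* u′ :+ q :* (v :* v′)) :* v″ :+ (u :* v′ :+ v :* u′) :* u″
                := u :* (u′ :* v″ :+ v′ :* u″) :+ v :* (u′ :* u″ :+ q :* (v′ :* v″)))
                refl q u v u′ v′ u″ v″
        ; *-identity =
              (λ (u , v) →
                  solve 3 (λ q u v → con (+ 1) :* u :+ q :* (con (+ 0) :* v) := u) refl q u v
                , solve 2 (λ u v → con (+ 1) :* v :+ con (+ 0) :* u := v) refl u v)
            , (λ (u , v) →
                  solve 3 (λ q u v → u :* con (+ 1) :+ q :* (v :* con (+ 0)) := u) refl q u v
                , solve 2 (λ u v → u :* con (+ 0) :+ v :* con (+ 1) := v) refl u v)
        ; distrib =
              (λ (u , v) (u′ , v′) (u″ , v″) →
                  solve 7 (λ q u v u′ v′ u″ v″ →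
                    u :* (u′ :+ u″) :+ q :* (v :* (v′ :+ v″))
                    := u :* u′ :+ q :* (v :* v′) :+ (u :* u″ :+ q :* (v :* v″)))
                    refl q u v u′ v′ u″ v″
                , solve 6 (λ u v u′ v′ u″ v″ →
                    u :* (v′ :+ v″) :+ v :* (u′ :+ u″)
                    := u :* v′ :+ v :* u′ :+ (u :* v″ :+ v :* u″))
                    refl u v u′ v′ u″ v″)
            , (λ (u , v) (u′ , v′) (u″ , v″) →
                  solve 7 (λ q u v u′ v′ u″ v″ →
                    (u′ :+ u″) :* u :+ q :* ((v′ :+ v″) :* v)
                    := u′ :* u :+ q :* (v′ :* v) :+ (u″ :* u :+ q :* (v″ :* v)))
                    refl q u v u′ v′ u″ v″
                , solve 6 (λ u v u′ v′ u″ v″ →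
                    (u′ :+ u″) :* v :+ (v′ :+ v″) :* u
                    := u′ :* v :+ v′ :* u :+ (u″ :* v :+ v″ :* u))
                    refl u v u′ v′ u″ v″)
        }
      ; *-comm = λ (u , v) (u′ , v′) →
            solve 5 (λ q u v u′ v′ →
              u :* u′ :+ q :* (v :* v′) := u′ :* u :+ q :* (v′ :* v)) refl q u v u′ v′
          , solve 4 (λ u v u′ v′ →
              u :* v′ :+ v :* u′ := u′ :* v :+ v′ :* u) refl u v u′ v′
      }
    }

-- Odd parts with respect to √q.

module OddPart {c ℓ} (R : CommutativeRing c ℓ)
  (q : CommutativeRing.Carrier R) (K : ℕ → CommutativeRing.Carrier R)
  (poch*K : QSeries.PochInverse R q K) where

  open CommutativeRing R
  open QSeries R
  open IntegerCoefficients R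
  open Congruence R
  open import Algebra.Properties.Ring ring using (-‿involutive)
  open import Algebra.Properties.Semiring.Exp semiring using (_^_)
  open import Relation.Binary.Reasoning.Setoid setoid

  private
    √R : CommutativeRing _ _
    √R = AdjoinSqrt.adjoinSqrt R q
    module S = CommutativeRing √R
    module F = QSeries √R
    module M = Congruence √R
    open import Algebra.Properties.Semiring.Exp S.semiring using ()
      renaming (_^_ to _^ₛ_)

    ι ο : Carrier → S.Carrier
    ι u = u , 0#
    ο u = 0# , u

    x : S.Carrier
    x = ο 1#

    ι-* : ∀ u v → ι u S.* ι v S.≈ ι (u * v)
    ι-* u v = solve 3 (λ q u v →
                u :* v :+ q :* (con (+ 0) :* con (+ 0)) := u :* v) refl q u v
            , solve 2 (λ u v → u :* con (+ 0) :+ con (+ 0) :* v := con (+ 0)) refl u v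

    ι-cong : ∀ {u v} → u ≈ v → ι u S.≈ ι v
    ι-cong u≈v = u≈v , refl

    ι-neg : ∀ u → S.- ι u S.≈ ι (- u)
    ι-neg u = refl , solve 0 (:- con (+ 0) := con (+ 0)) refl

    x*x≈ιq : x S.* x S.≈ ι q
    x*x≈ιq = solve 1 (λ q →
               con (+ 0) :* con (+ 0) :+ q :* (con (+ 1) :* con (+ 1)) := q) refl q
           , solve 0 (con (+ 0) :* con (+ 1) :+ con (+ 1) :* con (+ 0) := con (+ 0)) refl

    y^≈ι : ∀ n → (x S.* x) ^ₛ n S.≈ ι (q ^ n)
    y^≈ι zero    = S.refl
    y^≈ι (suc n) = S.trans (S.*-cong x*x≈ιq (y^≈ι n)) (ι-* q (q ^ n))

    poch≈ι : ∀ n → F.poch (x S.* x) n S.≈ ι (poch q n)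
    poch≈ι zero    = S.refl
    poch≈ι (suc n) = S.trans
      (S.*-cong (poch≈ι n)
        (S.trans (S.+-congˡ (S.trans (S.-‿cong (y^≈ι (suc n))) (ι-neg (q ^ suc n))))
          (refl , +-identityʳ 0#)))
      (ι-* (poch q n) (1# - q ^ suc n))

    sgn≈ι : ∀ n → F.sgn n S.≈ ι (sgn n)
    sgn≈ι zero    = S.refl
    sgn≈ι (suc n) = S.trans (S.-‿cong (sgn≈ι n)) (ι-neg (sgn n))

    I : ℕ → S.Carrier
    I n = ι (K n)

    poch*I : F.PochInverse (x S.* x) I
    poch*I n = S.trans (S.*-congʳ (poch≈ι n))
      (S.trans (ι-* (poch q n) (K n)) (ι-cong (poch*K n)))

    open EulerShanks √R x I poch*I
      using (a; b; t; G; pent; a-closed; b-closed; x^[2*]; y^≈x^2; euler-pentagonal)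

    x^even : ∀ e → x ^ₛ (2 ℕ.* e) S.≈ ι (q ^ e)
    x^even e = S.trans (x^[2*] e) (y^≈ι e)

    x^odd : ∀ e → x ^ₛ suc (2 ℕ.* e) S.≈ ο (q ^ e)
    x^odd e = S.trans (S.*-congˡ (x^even e))
      ( solve 2 (λ q u → con (+ 0) :* u :+ q :* (con (+ 1) :* con (+ 0)) := con (+ 0)) refl q (q ^ e)
      , solve 1 (λ u → con (+ 0) :* con (+ 0) :+ con (+ 1) :* u := u) refl (q ^ e))

    sgn*even : ∀ k e → proj₂ (F.sgn k S.* x ^ₛ (2 ℕ.* e)) ≈ 0#
    sgn*even k e = trans (proj₂ (S.*-cong (sgn≈ι k) (x^even e)))
      (proj₂ (ι-* (sgn k) (q ^ e)))

    sgn*odd : ∀ k e → F.sgn k S.* x ^ₛ suc (2 ℕ.* e) S.≈ ο (sgn k * q ^ e)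
    sgn*odd k e = S.trans (S.*-cong (sgn≈ι k) (x^odd e))
      ( solve 3 (λ q s u → s :* con (+ 0) :+ q :* (con (+ 0) :* u) := con (+ 0)) refl q (sgn k) (q ^ e)
      , solve 2 (λ s u → s :* u :+ con (+ 0) :* con (+ 0) := s :* u) refl (sgn k) (q ^ e))

    -- The outer 2 is the doubling of `b-closed`; the exponent of x itself is 2e here and 2e + 1 in
    -- `b-odd`.
    b-even : ∀ k n e → 2 ℕ.* (2 ℕ.* e) ≡ k ℕ.* (2 ℕ.* n ℕ.+ suc k) →
             proj₂ (b k n) ≈ 0#
    b-even k n e eq = trans (proj₂ (b-closed k n (2 ℕ.* e) eq)) (sgn*even k e)

    b-odd : ∀ k n e → 2 ℕ.* suc (2 ℕ.* e) ≡ k ℕ.* (2 ℕ.* n ℕ.+ suc k) →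
            proj₂ (b k n) ≈ sgn k * q ^ e
    b-odd k n e eq = trans (proj₂ (b-closed k n (suc (2 ℕ.* e)) eq)) (proj₂ (sgn*odd k e))

    sgn[2n] : ∀ n → sgn (n ℕ.* 2) ≈ 1#
    sgn[2n] zero    = refl
    sgn[2n] (suc n) = trans (-‿involutive _) (sgn[2n] n)

    sgn[4n] : ∀ n → sgn (n ℕ.* 4) ≈ 1#
    sgn[4n] zero    = refl
    sgn[4n] (suc n) = trans (-‿involutive _) (trans (-‿involutive _) (sgn[4n] n))

    t-even : ∀ n → proj₂ (t 0 (n ℕ.* 2)) ≈ 0#
    t-even n = trans (+-cong (*-congˡ refl) (*-congʳ a≈0))
      (solve 2 (λ u k → u :* con (+ 0) :+ con (+ 0) :* k := con (+ 0)) refl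
        (proj₁ (a 0 (n ℕ.* 2))) (K (n ℕ.* 2)))
      where
      exponent : ∀ n → n ℕ.* 2 ℕ.* (n ℕ.* 2) ≡ 2 ℕ.* (2 ℕ.* (n ℕ.* n))
      exponent = ℕ-Solver.solve-∀
      a≈0 : proj₂ (a 0 (n ℕ.* 2)) ≈ 0#
      a≈0 = trans (proj₂ (S.trans (a-closed (n ℕ.* 2))
        (S.reflexive (cong (λ e → F.sgn (n ℕ.* 2) S.* x ^ₛ e) (exponent n)))))
        (sgn*even (n ℕ.* 2) (2 ℕ.* (n ℕ.* n)))

    t-odd : ∀ n → proj₂ (t 0 (suc (n ℕ.* 2))) ≈
      - (q ^ (2 ℕ.* (n ℕ.* n) ℕ.+ 2 ℕ.* n) * K (suc (n ℕ.* 2)))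
    t-odd n = begin
      proj₂ (a 0 k S.* I k)
        ≈⟨ proj₂ (S.*-congʳ a≈) ⟩
      0# * 0# + - sgn (n ℕ.* 2) * q ^ e * K k
        ≈⟨ +-congˡ (*-congʳ (*-congʳ (-‿cong (sgn[2n] n)))) ⟩
      0# * 0# + - 1# * q ^ e * K k
        ≈⟨ solve 2 (λ u k →
             con (+ 0) :* con (+ 0) :+ :- con (+ 1) :* u :* k := :- (u :* k))
             refl (q ^ e) (K k) ⟩
      - (q ^ e * K k)    ∎
      where
      k = suc (n ℕ.* 2)
      e = 2 ℕ.* (n ℕ.* n) ℕ.+ 2 ℕ.* n
      exponent : ∀ n → suc (n ℕ.* 2) ℕ.* suc (n ℕ.* 2)
        ≡ suc (2 ℕ.* (2 ℕ.* (n ℕ.* n) ℕ.+ 2 ℕ.* n))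
      exponent = ℕ-Solver.solve-∀
      a≈ : a 0 k S.≈ ο (sgn k * q ^ e)
      a≈ = S.trans (S.trans (a-closed k)
        (S.reflexive (cong (λ e → F.sgn k S.* x ^ₛ e) (exponent n))))
        (sgn*odd k e)

  lhs : ℕ → Carrier
  lhs n = q ^ (2 ℕ.* (n ℕ.* n) ℕ.+ 2 ℕ.* n) * K (suc (n ℕ.* 2))

  -- The odd values of k(3k-1)/2 and k(3k+1)/2 for k ≥ 1 are the numbers 2e + 1 with these e: `α`
  -- belongs to k = 4i + 1, `β` and `γ` to k = 4i + 2, `δ` to k = 4i + 3.
  α β γ δ : ℕ → ℕ
  α i = 12 ℕ.* (i ℕ.* i) ℕ.+ 5 ℕ.* i
  β i = 12 ℕ.* (i ℕ.* i) ℕ.+ 11 ℕ.* i ℕ.+ 2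
  γ i = 12 ℕ.* (i ℕ.* i) ℕ.+ 13 ℕ.* i ℕ.+ 3
  δ i = 12 ℕ.* (i ℕ.* i) ℕ.+ 19 ℕ.* i ℕ.+ 7

  rhs : ℕ → Carrier
  rhs i = q ^ α i - q ^ β i - q ^ γ i + q ^ δ i

  private
    G-odd : ∀ L → proj₂ (G 0 (L ℕ.* 2)) ≈ - Σ< lhs L
    G-odd zero    = solve 0 (con (+ 0) := :- con (+ 0)) refl
    G-odd (suc L) = trans (+-cong (+-cong (G-odd L) (t-even L)) (t-odd L))
      (solve 2 (λ s u → :- s :+ con (+ 0) :- u := :- (s :+ u)) refl (Σ< lhs L) (lhs L))

    -- The parity pattern of the pentagonal exponents has period 4 in k, so one step takes four
    -- values of k, that is eight terms, of which four have odd exponent.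
    pent-odd : ∀ L → proj₂ (pent (L ℕ.* 4)) ≈ - Σ< rhs L
    pent-odd zero    = solve 0 (con (+ 0) := :- con (+ 0)) refl
    pent-odd (suc i) = trans
      (+-cong (+-cong (+-cong (+-cong (pent-odd i)
        (+-cong (b-odd (1 ℕ.+ n) n (α i) (α-eq i)) (b-even (1 ℕ.+ n) (1 ℕ.+ n) (α′ i) (α′-eq i))))
        (+-cong (b-odd (2 ℕ.+ n) (1 ℕ.+ n) (β i) (β-eq i)) (b-odd (2 ℕ.+ n) (2 ℕ.+ n) (γ i) (γ-eq i))))
        (+-cong (b-even (3 ℕ.+ n) (2 ℕ.+ n) (δ′ i) (δ′-eq i)) (b-odd (3 ℕ.+ n) (3 ℕ.+ n) (δ i) (δ-eq i))))
        (+-cong (b-even (4 ℕ.+ n) (3 ℕ.+ n) (ε i) (ε-eq i)) (b-even (4 ℕ.+ n) (4 ℕ.+ n) (ε′ i) (ε′-eq i))))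
      (trans (+-congʳ (+-cong (+-cong (+-congˡ
          (+-congʳ (*-congʳ (-‿cong σ))))
          (+-cong (*-congʳ (-‿cong (-‿cong σ))) (*-congʳ (-‿cong (-‿cong σ)))))
          (+-congˡ (*-congʳ (-‿cong (-‿cong (-‿cong σ)))))))
        (solve 5 (λ s a b c d →
          :- s :+ (:- con (+ 1) :* a :+ con (+ 0))
            :+ (:- :- con (+ 1) :* b :+ :- :- con (+ 1) :* c)
            :+ (con (+ 0) :+ :- :- :- con (+ 1) :* d)
            :+ (con (+ 0) :+ con (+ 0))
          := :- (s :+ (a :- b :- c :+ d)))
          refl (Σ< rhs i) (q ^ α i) (q ^ β i) (q ^ γ i) (q ^ δ i)))
      where
      n = i ℕ.* 4
      σ = sgn[4n] i
      -- Halves of the even exponents: one each from k = 4i + 1 and k = 4i + 3, both from k = 4i +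
      -- 4.
      α′ δ′ ε ε′ : ℕ → ℕ
      α′ i = 12 ℕ.* (i ℕ.* i) ℕ.+ 7 ℕ.* i ℕ.+ 1
      δ′ i = 12 ℕ.* (i ℕ.* i) ℕ.+ 17 ℕ.* i ℕ.+ 6
      ε  i = 12 ℕ.* (i ℕ.* i) ℕ.+ 23 ℕ.* i ℕ.+ 11
      ε′ i = 12 ℕ.* (i ℕ.* i) ℕ.+ 25 ℕ.* i ℕ.+ 13
      α-eq : ∀ i → 2 ℕ.* suc (2 ℕ.* (12 ℕ.* (i ℕ.* i) ℕ.+ 5 ℕ.* i))
        ≡ (1 ℕ.+ i ℕ.* 4) ℕ.* (2 ℕ.* (i ℕ.* 4) ℕ.+ (2 ℕ.+ i ℕ.* 4))
      α-eq = ℕ-Solver.solve-∀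
      α′-eq : ∀ i → 2 ℕ.* (2 ℕ.* (12 ℕ.* (i ℕ.* i) ℕ.+ 7 ℕ.* i ℕ.+ 1))
        ≡ (1 ℕ.+ i ℕ.* 4) ℕ.* (2 ℕ.* (1 ℕ.+ i ℕ.* 4) ℕ.+ (2 ℕ.+ i ℕ.* 4))
      α′-eq = ℕ-Solver.solve-∀
      β-eq : ∀ i → 2 ℕ.* suc (2 ℕ.* (12 ℕ.* (i ℕ.* i) ℕ.+ 11 ℕ.* i ℕ.+ 2))
        ≡ (2 ℕ.+ i ℕ.* 4) ℕ.* (2 ℕ.* (1 ℕ.+ i ℕ.* 4) ℕ.+ (3 ℕ.+ i ℕ.* 4))
      β-eq = ℕ-Solver.solve-∀
      γ-eq : ∀ i → 2 ℕ.* suc (2 ℕ.* (12 ℕ.* (i ℕ.* i) ℕ.+ 13 ℕ.* i ℕ.+ 3))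
        ≡ (2 ℕ.+ i ℕ.* 4) ℕ.* (2 ℕ.* (2 ℕ.+ i ℕ.* 4) ℕ.+ (3 ℕ.+ i ℕ.* 4))
      γ-eq = ℕ-Solver.solve-∀
      δ′-eq : ∀ i → 2 ℕ.* (2 ℕ.* (12 ℕ.* (i ℕ.* i) ℕ.+ 17 ℕ.* i ℕ.+ 6))
        ≡ (3 ℕ.+ i ℕ.* 4) ℕ.* (2 ℕ.* (2 ℕ.+ i ℕ.* 4) ℕ.+ (4 ℕ.+ i ℕ.* 4))
      δ′-eq = ℕ-Solver.solve-∀
      δ-eq : ∀ i → 2 ℕ.* suc (2 ℕ.* (12 ℕ.* (i ℕ.* i) ℕ.+ 19 ℕ.* i ℕ.+ 7))
        ≡ (3 ℕ.+ i ℕ.* 4) ℕ.* (2 ℕ.* (3 ℕ.+ i ℕ.* 4) ℕ.+ (4 ℕ.+ i ℕ.* 4))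
      δ-eq = ℕ-Solver.solve-∀
      ε-eq : ∀ i → 2 ℕ.* (2 ℕ.* (12 ℕ.* (i ℕ.* i) ℕ.+ 23 ℕ.* i ℕ.+ 11))
        ≡ (4 ℕ.+ i ℕ.* 4) ℕ.* (2 ℕ.* (3 ℕ.+ i ℕ.* 4) ℕ.+ (5 ℕ.+ i ℕ.* 4))
      ε-eq = ℕ-Solver.solve-∀
      ε′-eq : ∀ i → 2 ℕ.* (2 ℕ.* (12 ℕ.* (i ℕ.* i) ℕ.+ 25 ℕ.* i ℕ.+ 13))
        ≡ (4 ℕ.+ i ℕ.* 4) ℕ.* (2 ℕ.* (4 ℕ.+ i ℕ.* 4) ℕ.+ (5 ℕ.+ i ℕ.* 4))
      ε′-eq = ℕ-Solver.solve-∀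

  private
    -- The q-factorial and the modulus lie in R, so they act on odd parts separately. Both odd parts
    -- carry a minus sign; hence the cofactor is the negated odd part of the given one.
    odd-part-of : ∀ L →
      G 0 (L ℕ.* 2) S.* F.poch (x S.* x) (L ℕ.* 2)
        M.≈ S.1# S.+ pent (L ℕ.* 2 ℕ.* 2) [mod ι (q ^ L) ] →
      Σ< lhs L * poch q (L ℕ.* 2) ≈ Σ< rhs L [mod q ^ L ]
    odd-part-of L ((h₁ , h₂) , eq) = - h₂ , (begin
      Σ< lhs L * P
        ≈⟨ solve 3 (λ g s p → s :* p := :- (g :* con (+ 0) :+ :- s :* p)) refl g₁ _ P ⟩
      - (g₁ * 0# + - Σ< lhs L * P)
        ≈⟨ -‿cong (+-congˡ (*-congʳ (G-odd L))) ⟨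
      - proj₂ (G 0 (L ℕ.* 2) S.* ι P)
        ≈⟨ -‿cong (proj₂ (S.*-congˡ {G 0 (L ℕ.* 2)} (poch≈ι (L ℕ.* 2)))) ⟨
      - proj₂ (G 0 (L ℕ.* 2) S.* F.poch (x S.* x) (L ℕ.* 2))
        ≈⟨ -‿cong (proj₂ eq) ⟩
      - (0# + proj₂ (pent (L ℕ.* 2 ℕ.* 2)) + (q ^ L * h₂ + 0# * h₁))
        ≡⟨ cong (λ k → - (0# + proj₂ (pent k) + (q ^ L * h₂ + 0# * h₁)))
             (ℕ.*-assoc L 2 2) ⟩
      - (0# + proj₂ (pent (L ℕ.* 4)) + (q ^ L * h₂ + 0# * h₁))
        ≈⟨ -‿cong (+-congʳ (+-congˡ (pent-odd L))) ⟩
      - (0# + - Σ< rhs L + (q ^ L * h₂ + 0# * h₁))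
        ≈⟨ solve 4 (λ s q h₂ h₁ →
             :- (con (+ 0) :- s :+ (q :* h₂ :+ con (+ 0) :* h₁)) := s :+ q :* (:- h₂))
             refl (Σ< rhs L) (q ^ L) h₂ h₁ ⟩
      Σ< rhs L + q ^ L * - h₂    ∎)
      where
      P = poch q (L ℕ.* 2)
      g₁ = proj₁ (G 0 (L ℕ.* 2))

  odd-part : ∀ l → let L = suc l in
    Σ< lhs L * poch q (L ℕ.* 2) ≈ Σ< rhs L [mod q ^ L ]
  -- An even truncation 2L, with L = l + 1, makes the modulus x^(2L) = q^L an element of R.
  odd-part l = odd-part-of (suc l) (M.mod-cong
    (S.trans (S.sym (y^≈x^2 (suc l))) (y^≈ι (suc l))) (euler-pentagonal (suc (l ℕ.* 2))))

-- The ring of formal power series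

open import Defs

-- This local form of congruence allows limits to be replaced by finite approximations within a
-- fixed coefficient.
*-cong-≤ : ∀ {f f′ g g′} n → (∀ j → j ℕ.≤ n → f j ≡ f′ j) →
           (∀ j → j ℕ.≤ n → g j ≡ g′ j) → (f * g) n ≡ (f′ * g′) n
*-cong-≤ zero    f≡ g≡ = cong (ℤ._+ 0ℤ) (cong₂ ℤ._*_ (f≡ 0 z≤n) (g≡ 0 z≤n))
*-cong-≤ (suc n) f≡ g≡ = cong₂ ℤ._+_
  (cong₂ ℤ._*_ (f≡ 0 z≤n) (g≡ (suc n) ℕ.≤-refl))
  (*-cong-≤ n (λ j j≤n → f≡ (suc j) (s≤s j≤n))
              (λ j j≤n → g≡ j (ℕ.m≤n⇒m≤1+n j≤n)))

*-cong : ∀ {f f′ g g′} → f ≈ f′ → g ≈ g′ → f * g ≈ f′ * g′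
*-cong f≈ g≈ n = *-cong-≤ n (λ j _ → f≈ j) (λ j _ → g≈ j)

*-zeroˡ : ∀ f → 0# * f ≈ 0#
*-zeroˡ f zero    = ≡.refl
*-zeroˡ f (suc n) = ≡.trans (ℤ.+-identityˡ _) (*-zeroˡ f n)

*-identityˡ : ∀ f → 1# * f ≈ f
*-identityˡ f zero    = ≡.trans (ℤ.+-identityʳ _) (ℤ.*-identityˡ (f 0))
*-identityˡ f (suc n) = ≡.trans
  (cong₂ ℤ._+_ (ℤ.*-identityˡ (f (suc n))) (*-zeroˡ f n))
  (ℤ.+-identityʳ (f (suc n)))

*-distribʳ-+ : ∀ h f g → (f + g) * h ≈ f * h + g * h
*-distribʳ-+ h f g zero    = identity (f 0) (g 0) (h 0)
  where
  identity : ∀ a b c →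
    (a ℤ.+ b) ℤ.* c ℤ.+ 0ℤ ≡ (a ℤ.* c ℤ.+ 0ℤ) ℤ.+ (b ℤ.* c ℤ.+ 0ℤ)
  identity = ℤ-Solver.solve-∀
*-distribʳ-+ h f g (suc n) = ≡.trans
  (cong (ℤ._+_ ((f 0 ℤ.+ g 0) ℤ.* h (suc n))) (*-distribʳ-+ h (f ∘ suc) (g ∘ suc) n))
  (identity (f 0) (g 0) (h (suc n)) (((f ∘ suc) * h) n) (((g ∘ suc) * h) n))
  where
  identity : ∀ a b c u v →
    (a ℤ.+ b) ℤ.* c ℤ.+ (u ℤ.+ v) ≡ (a ℤ.* c ℤ.+ u) ℤ.+ (b ℤ.* c ℤ.+ v)
  identity = ℤ-Solver.solve-∀

*-scaleˡ : ∀ k f g → (λ n → k ℤ.* f n) * g ≈ (λ n → k ℤ.* (f * g) n)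
*-scaleˡ k f g zero    = identity k (f 0) (g 0)
  where
  identity : ∀ k a b → k ℤ.* a ℤ.* b ℤ.+ 0ℤ ≡ k ℤ.* (a ℤ.* b ℤ.+ 0ℤ)
  identity = ℤ-Solver.solve-∀
*-scaleˡ k f g (suc n) = ≡.trans
  (cong (ℤ._+_ (k ℤ.* f 0 ℤ.* g (suc n))) (*-scaleˡ k (f ∘ suc) g n))
  (identity k (f 0) (g (suc n)) (((f ∘ suc) * g) n))
  where
  identity : ∀ k a b u → k ℤ.* a ℤ.* b ℤ.+ k ℤ.* u ≡ k ℤ.* (a ℤ.* b ℤ.+ u)
  identity = ℤ-Solver.solve-∀

-- By computation the tail of `f * g` is `f₀g′ + f′ * g`, so distributivity and scaling reduce the
-- claim to the tail of f.
*-assoc : ∀ f g h → (f * g) * h ≈ f * (g * h)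
*-assoc f g h zero    = identity (f 0) (g 0) (h 0)
  where
  identity : ∀ a b c →
    (a ℤ.* b ℤ.+ 0ℤ) ℤ.* c ℤ.+ 0ℤ ≡ a ℤ.* (b ℤ.* c ℤ.+ 0ℤ) ℤ.+ 0ℤ
  identity = ℤ-Solver.solve-∀
*-assoc f g h (suc n) = begin
  u ℤ.+ ((f₀g′ + f′ * g) * h) n
    ≡⟨ cong (ℤ._+_ u) (*-distribʳ-+ h f₀g′ (f′ * g) n) ⟩
  u ℤ.+ ((f₀g′ * h) n ℤ.+ ((f′ * g) * h) n)
    ≡⟨ cong (ℤ._+_ u) (cong₂ ℤ._+_ (*-scaleˡ (f 0) (g ∘ suc) h n) (*-assoc f′ g h n)) ⟩
  u ℤ.+ (f 0 ℤ.* ((g ∘ suc) * h) n ℤ.+ (f′ * (g * h)) n)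
    ≡⟨ identity (f 0) (g 0) (h (suc n)) (((g ∘ suc) * h) n) ((f′ * (g * h)) n) ⟩
  (f * (g * h)) (suc n)    ∎
  where
  open ≡.≡-Reasoning
  f′ f₀g′ : Series
  f′ = f ∘ suc
  f₀g′ n = f 0 ℤ.* g (suc n)
  u = (f 0 ℤ.* g 0 ℤ.+ 0ℤ) ℤ.* h (suc n)
  identity : ∀ a b c u v →
    (a ℤ.* b ℤ.+ 0ℤ) ℤ.* c ℤ.+ (a ℤ.* u ℤ.+ v) ≡ a ℤ.* (b ℤ.* c ℤ.+ u) ℤ.+ v
  identity = ℤ-Solver.solve-∀

-- The definition splits off the first summand, this lemma the last; commutativity compares the two
-- expansions.
*-sucʳ : ∀ f g n → (f * g) (suc n) ≡ f (suc n) ℤ.* g 0 ℤ.+ (f * (g ∘ suc)) n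
*-sucʳ f g zero    = identity (f 0) (f 1) (g 0) (g 1)
  where
  identity : ∀ a a′ b b′ → a ℤ.* b′ ℤ.+ (a′ ℤ.* b ℤ.+ 0ℤ)
    ≡ a′ ℤ.* b ℤ.+ (a ℤ.* b′ ℤ.+ 0ℤ)
  identity = ℤ-Solver.solve-∀
*-sucʳ f g (suc n) = ≡.trans
  (cong (ℤ._+_ (f 0 ℤ.* g (suc (suc n)))) (*-sucʳ (f ∘ suc) g n))
  (identity (f 0 ℤ.* g (suc (suc n))) (f (suc (suc n)) ℤ.* g 0)
    (((f ∘ suc) * (g ∘ suc)) n))
  where
  identity : ∀ u v w → u ℤ.+ (v ℤ.+ w) ≡ v ℤ.+ (u ℤ.+ w)
  identity = ℤ-Solver.solve-∀

*-comm : ∀ f g → f * g ≈ g * f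
*-comm f g zero    = cong (ℤ._+ 0ℤ) (ℤ.*-comm (f 0) (g 0))
*-comm f g (suc n) = ≡.trans
  (cong₂ ℤ._+_ (ℤ.*-comm (f 0) (g (suc n))) (*-comm (f ∘ suc) g n))
  (≡.sym (*-sucʳ g f n))

seriesRing : CommutativeRing _ _
seriesRing = record
  { Carrier = Series
  ; _≈_     = _≈_
  ; _+_     = _+_
  ; _*_     = _*_
  ; -_      = λ f n → ℤ.- f n
  ; 0#      = 0#
  ; 1#      = 1#
  ; isCommutativeRing = record
    { isRing = record
      { +-isAbelianGroup = record
        { isGroup = record
          { isMonoid = record
            { isSemigroup = record
              { isMagma = record
                { isEquivalence = record
                  { refl  = λ _ → ≡.refl
                  ; sym   = λ f≈g n → ≡.sym (f≈g n)
                  ; trans = λ f≈g g≈h n → ≡.trans (f≈g n) (g≈h n)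
                  }
                ; ∙-cong = λ f≈ g≈ n → cong₂ ℤ._+_ (f≈ n) (g≈ n)
                }
              ; assoc = λ f g h n → ℤ.+-assoc (f n) (g n) (h n)
              }
            ; identity = (λ f n → ℤ.+-identityˡ (f n)) , (λ f n → ℤ.+-identityʳ (f n))
            }
          ; inverse = (λ f n → ℤ.+-inverseˡ (f n)) , (λ f n → ℤ.+-inverseʳ (f n))
          ; ⁻¹-cong = λ f≈g n → cong ℤ.-_ (f≈g n)
          }
        ; comm = λ f g n → ℤ.+-comm (f n) (g n)
        }
      ; *-cong = *-cong
      ; *-assoc = *-assoc
      ; *-identity = *-identityˡ
                   , λ f n → ≡.trans (*-comm f 1# n) (*-identityˡ f n)
      ; distrib = (λ f g h n → ≡.trans (*-comm f (g + h) n)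
                    (≡.trans (*-distribʳ-+ f g h n)
                      (cong₂ ℤ._+_ (*-comm g f n) (*-comm h f n))))
                , *-distribʳ-+
      }
    ; *-comm = *-comm
    }
  }

-- Powers of q and the left-hand terms in the series ring.

module S = CommutativeRing seriesRing
open QSeries seriesRing using (Σ<; poch)
open import Algebra.Properties.Semiring.Exp S.semiring using (_^_)

q : Series
q = q^ (+ 1)

q^-diagonal : ∀ n → (q^ (+ n)) n ≡ 1ℤ
q^-diagonal n with + n ℤ.≟ + n
... | yes _  = ≡.refl
... | no n≢n = contradiction ≡.refl n≢n

q^-off-diagonal : ∀ {e n} → e ≢ + n → (q^ e) n ≡ 0ℤ
q^-off-diagonal {e} {n} e≢n with e ℤ.≟ + n
... | yes e≡n = contradiction e≡n e≢n
... | no  _   = ≡.refl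

q^-suc : ∀ e n → (q^ (+ suc e)) (suc n) ≡ (q^ (+ e)) n
q^-suc e n = by-cases (e ℕ.≟ n)
  where
  by-cases : Dec (e ≡ n) → (q^ (+ suc e)) (suc n) ≡ (q^ (+ e)) n
  by-cases (yes ≡.refl) = ≡.trans (q^-diagonal (suc e)) (≡.sym (q^-diagonal e))
  by-cases (no  e≢n)    = ≡.trans
    (q^-off-diagonal (e≢n ∘ ℕ.suc-injective ∘ ℤ.+-injective))
    (≡.sym (q^-off-diagonal (e≢n ∘ ℤ.+-injective)))

q*-suc : ∀ f n → (q * f) (suc n) ≡ f n
q*-suc f n = ≡.trans (ℤ.+-identityˡ _)
  (≡.trans (*-cong {g = f} (q^-suc 0) (λ _ → ≡.refl) n) (*-identityˡ f n))

q^≈^ : ∀ e → q^ (+ e) ≈ q ^ e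
q^≈^ zero    n       = ≡.refl
q^≈^ (suc e) zero    = ≡.refl
q^≈^ (suc e) (suc n) = ≡.trans (q^-suc e n)
  (≡.trans (q^≈^ e n) (≡.sym (q*-suc (q ^ e) n)))

qPoch≈poch : ∀ n → qPoch n ≈ poch q n
qPoch≈poch zero    = S.refl
qPoch≈poch (suc n) = S.*-cong (qPoch≈poch n) (S.+-congˡ {1#} (S.-‿cong (q^≈^ (suc n))))

open OddPart seriesRing q (λ n → qPoch n ⁻¹)
  (λ n → S.trans (S.*-congʳ (S.sym (qPoch≈poch n))) (qPoch-inverse n))
  using (lhs; rhs; α; β; γ; δ; odd-part)

lhsTerm≈ : ∀ n → lhsTerm n ≈ lhs n
lhsTerm≈ n = S.*-cong
  (S.trans (S.reflexive (cong (λ e → q^ (+ e)) (exponent n)))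
    (q^≈^ (2 ℕ.* (n ℕ.* n) ℕ.+ 2 ℕ.* n)))
  (S.reflexive (cong (λ k → qPoch k ⁻¹) (index n)))
  where
  exponent : ∀ n → 2 ℕ.* (n ℕ.* (n ℕ.* 1)) ℕ.+ 2 ℕ.* n ≡ 2 ℕ.* (n ℕ.* n) ℕ.+ 2 ℕ.* n
  exponent = ℕ-Solver.solve-∀
  index : ∀ n → 2 ℕ.* n ℕ.+ 1 ≡ suc (n ℕ.* 2)
  index = ℕ-Solver.solve-∀

partialSum-lhs : ∀ L → partialSum lhsTerm L ≈ Σ< lhs L
partialSum-lhs zero    = S.refl
partialSum-lhs (suc L) = S.+-cong (partialSum-lhs L) (lhsTerm≈ L)

-- The exponents of the sum over k and the rearrangement of its partial sums.

pos-quadratic : ∀ a b c n → + (a ℕ.* (n ℕ.* n) ℕ.+ b ℕ.* n ℕ.+ c)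
  ≡ + a ℤ.* (+ n ℤ.* + n) ℤ.+ + b ℤ.* + n ℤ.+ + c
pos-quadratic a b c n
  rewrite ≡.sym (ℤ.pos-* n n) | ≡.sym (ℤ.pos-* a (n ℕ.* n)) | ≡.sym (ℤ.pos-* b n)
  = ≡.refl

-- k and x are variables because normalising e₁ or e₂ at + suc n is very slow.
e₁-shape : ∀ k x → k ≡ x → e₁ k ≡ + 12 ℤ.* (x ℤ.* x) ℤ.+ + 5 ℤ.* x ℤ.+ + 0
e₁-shape k x k≡ = ≡.trans (cong e₁ k≡) (identity x)
  where
  identity : ∀ x → + 12 ℤ.* (x ℤ.* (x ℤ.* 1ℤ)) ℤ.+ + 5 ℤ.* x
    ≡ + 12 ℤ.* (x ℤ.* x) ℤ.+ + 5 ℤ.* x ℤ.+ + 0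
  identity = ℤ-Solver.solve-∀

e₁-shape⁻ : ∀ k x → k ≡ ℤ.- (1ℤ ℤ.+ x) →
  e₁ k ≡ + 12 ℤ.* (x ℤ.* x) ℤ.+ + 19 ℤ.* x ℤ.+ + 7
e₁-shape⁻ k x k≡ = ≡.trans (cong e₁ k≡) (identity x)
  where
  identity : ∀ x → let y = ℤ.- (1ℤ ℤ.+ x) in
    + 12 ℤ.* (y ℤ.* (y ℤ.* 1ℤ)) ℤ.+ + 5 ℤ.* y
    ≡ + 12 ℤ.* (x ℤ.* x) ℤ.+ + 19 ℤ.* x ℤ.+ + 7
  identity = ℤ-Solver.solve-∀

e₂-shape : ∀ k x → k ≡ 1ℤ ℤ.+ x →
  e₂ k ≡ + 12 ℤ.* (x ℤ.* x) ℤ.+ + 11 ℤ.* x ℤ.+ + 2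
e₂-shape k x k≡ = ≡.trans (cong e₂ k≡) (identity x)
  where
  identity : ∀ x → let y = 1ℤ ℤ.+ x in
    + 12 ℤ.* (y ℤ.* (y ℤ.* 1ℤ)) ℤ.- + 13 ℤ.* y ℤ.+ + 3
    ≡ + 12 ℤ.* (x ℤ.* x) ℤ.+ + 11 ℤ.* x ℤ.+ + 2
  identity = ℤ-Solver.solve-∀

e₂-shape⁻ : ∀ k x → k ≡ ℤ.- (1ℤ ℤ.+ x) →
  e₂ k ≡ + 12 ℤ.* (x ℤ.* x) ℤ.+ + 37 ℤ.* x ℤ.+ + 28
e₂-shape⁻ k x k≡ = ≡.trans (cong e₂ k≡) (identity x)
  where
  identity : ∀ x → let y = ℤ.- (1ℤ ℤ.+ x) in
    + 12 ℤ.* (y ℤ.* (y ℤ.* 1ℤ)) ℤ.- + 13 ℤ.* y ℤ.+ + 3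
    ≡ + 12 ℤ.* (x ℤ.* x) ℤ.+ + 37 ℤ.* x ℤ.+ + 28
  identity = ℤ-Solver.solve-∀

e₁≡α : ∀ n → e₁ (+ n) ≡ + α n
e₁≡α n = ≡.trans (e₁-shape (+ n) (+ n) ≡.refl)
  (≡.trans (≡.sym (pos-quadratic 12 5 0 n)) (cong +_ (ℕ.+-identityʳ _)))

e₁≡δ : ∀ n → e₁ -[1+ n ] ≡ + δ n
e₁≡δ n = ≡.trans (e₁-shape⁻ -[1+ n ] (+ n) ≡.refl) (≡.sym (pos-quadratic 12 19 7 n))

e₂≡β : ∀ n → e₂ (+ suc n) ≡ + β n
e₂≡β n = ≡.trans (e₂-shape (+ suc n) (+ n) ≡.refl) (≡.sym (pos-quadratic 12 11 2 n))

-- For k ≥ 0, e₂ at -k is `γ k`, so the negative half starts at `γ 1`, while `γ 0` = 3 is e₂ at 0.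
e₂≡γ : ∀ n → e₂ -[1+ n ] ≡ + γ (suc n)
e₂≡γ n = ≡.trans (e₂-shape⁻ -[1+ n ] (+ n) ≡.refl)
  (≡.trans (≡.sym (pos-quadratic 12 37 28 n)) (cong +_ (shift n)))
  where
  shift : ∀ n → 12 ℕ.* (n ℕ.* n) ℕ.+ 37 ℕ.* n ℕ.+ 28
    ≡ 12 ℕ.* (suc n ℕ.* suc n) ℕ.+ 13 ℕ.* suc n ℕ.+ 3
  shift = ℕ-Solver.solve-∀

q^e≈ : ∀ {e n} → e ≡ + n → q^ e ≈ q ^ n
q^e≈ {n = n} e≡ = S.trans (S.reflexive (cong q^_ e≡)) (q^≈^ n)

-- Σ< rhs pairs the exponents as e₁ L, e₁ (-1-L), e₂ (L+1), e₂ (-L), the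
-- partial sums of rhsTerm pair e₂ L with e₂ (-1-L): the difference telescopes.
partialSum-rhs : ∀ L →
  partialSum (rhsTerm ∘ +_) L + partialSum (rhsTerm ∘ -[1+_]) L
    - q^ (e₂ (+ L)) + q ^ γ L
  ≈ Σ< rhs L
partialSum-rhs zero    n = ≡.trans
  (cong (ℤ._+_ ((0ℤ ℤ.+ 0ℤ) ℤ.- (q^ (+ 3)) n)) (≡.sym (q^≈^ 3 n)))
  (identity ((q^ (+ 3)) n))
  where
  identity : ∀ u → (0ℤ ℤ.+ 0ℤ) ℤ.- u ℤ.+ u ≡ 0ℤ
  identity = ℤ-Solver.solve-∀
partialSum-rhs (suc L) n = begin
  _ ≡⟨ identity p m ((q^ (e₁ (+ L))) n) b ((q^ (e₁ -[1+ L ])) n)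
         ((q^ (e₂ -[1+ L ])) n) ((q^ (e₂ (+ suc L))) n) ((q ^ γ (suc L)) n) c ⟩
  (p ℤ.+ m ℤ.- b ℤ.+ c)
    ℤ.+ ((q^ (e₁ (+ L))) n ℤ.- (q^ (e₂ (+ suc L))) n ℤ.- c ℤ.+ (q^ (e₁ -[1+ L ])) n)
    ℤ.+ ((q ^ γ (suc L)) n ℤ.- (q^ (e₂ -[1+ L ])) n)
    ≡⟨ cong₂ ℤ._+_ (cong₂ ℤ._+_ (partialSum-rhs L n)
         (cong₂ ℤ._+_ (cong (ℤ._- c) (cong₂ ℤ._-_ (q^e≈ (e₁≡α L) n) (q^e≈ (e₂≡β L) n)))
           (q^e≈ (e₁≡δ L) n)))
         (cong (ℤ._-_ ((q ^ γ (suc L)) n)) (q^e≈ (e₂≡γ L) n)) ⟩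
  Σ< rhs (suc L) n ℤ.+ ((q ^ γ (suc L)) n ℤ.- (q ^ γ (suc L)) n)
    ≡⟨ cong (ℤ._+_ (Σ< rhs (suc L) n)) (ℤ.+-inverseʳ ((q ^ γ (suc L)) n)) ⟩
  Σ< rhs (suc L) n ℤ.+ 0ℤ
    ≡⟨ ℤ.+-identityʳ _ ⟩
  Σ< rhs (suc L) n    ∎
  where
  open ≡.≡-Reasoning
  p = partialSum (rhsTerm ∘ +_) L n
  m = partialSum (rhsTerm ∘ -[1+_]) L n
  b = (q^ (e₂ (+ L))) n
  c = (q ^ γ L) n
  identity : ∀ p m a b d g b′ g′ c →
    (p ℤ.+ (a ℤ.- b)) ℤ.+ (m ℤ.+ (d ℤ.- g)) ℤ.- b′ ℤ.+ g′
    ≡ (p ℤ.+ m ℤ.- b ℤ.+ c) ℤ.+ (a ℤ.- b′ ℤ.- c ℤ.+ d) ℤ.+ (g′ ℤ.- g)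
  identity = ℤ-Solver.solve-∀

-- Passage to the limit, coefficient by coefficient.

lim-coefficient : ∀ {F} (c : Convergent F) m {n} → proj₁ (c m) ℕ.≤ n → lim F c m ≡ F n m
lim-coefficient c m N≤n = ≡.sym (proj₂ (c m) _ N≤n)

Σlhs : Series
Σlhs = Σℕ lhsTerm lhsTerm-summable

Σrhs : Series
Σrhs = Σℤ rhsTerm rhsTerm-summable

-- For coefficient m everything is truncated at L = m + 1, and all error terms are then of order at
-- least L.
Σlhs*qPoch∞ : Σlhs * qPoch∞ ≈ Σrhs
Σlhs*qPoch∞ m = begin
  (Σlhs * qPoch∞) m
    ≡⟨ *-cong-≤ {g = qPoch∞} {g′ = poch q (L ℕ.* 2)} m
         -- Coefficient j is stable from j + 1 summands on in the series and from index j on in the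
         -- product.
         (λ j j≤m → ≡.trans (lim-coefficient lhsTerm-summable j (s≤s j≤m))
                            (partialSum-lhs L j))
         (λ j j≤m → ≡.trans (lim-coefficient qPoch-convergent j
                              (ℕ.≤-trans j≤m (ℕ.≤-trans (ℕ.n≤1+n m) (ℕ.m≤m*n L 2))))
                            (qPoch≈poch (L ℕ.* 2) j)) ⟩
  (Σ< lhs L * poch q (L ℕ.* 2)) m
    ≡⟨ proj₂ (odd-part m) m ⟩
  Σ< rhs L m ℤ.+ (q ^ L * h) m
    ≡⟨ cong (ℤ._+_ (Σ< rhs L m)) (≡.trans (*-cong {g = h} (S.sym (q^≈^ L)) (λ _ → ≡.refl) m)
         (q^*-below {+ L} {m} h (+<+ ℕ.≤-refl))) ⟩
  Σ< rhs L m ℤ.+ 0ℤ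
    ≡⟨ ℤ.+-identityʳ _ ⟩
  Σ< rhs L m
    ≡⟨ partialSum-rhs L m ⟨
  s⁺ ℤ.+ s⁻ ℤ.- (q^ (e₂ (+ L))) m ℤ.+ (q ^ γ L) m
    -- The two boundary terms of the telescoping have exponents at least L > m.
    ≡⟨ cong₂ (λ u v → s⁺ ℤ.+ s⁻ ℤ.- u ℤ.+ v)
         (q^-below (ℤ.<-≤-trans (+<+ ℕ.≤-refl) (e₂-bound (+ L))))
         (≡.trans (≡.sym (q^≈^ (γ L) m)) (q^-below (+<+ L≤γ))) ⟩
  s⁺ ℤ.+ s⁻ ℤ.- 0ℤ ℤ.+ 0ℤ
    ≡⟨ ≡.trans (ℤ.+-identityʳ _) (ℤ.+-identityʳ _) ⟩
  s⁺ ℤ.+ s⁻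
    ≡⟨ cong₂ ℤ._+_ (lim-coefficient (proj₁ rhsTerm-summable) m ℕ.≤-refl)
                   (lim-coefficient (proj₂ rhsTerm-summable) m ℕ.≤-refl) ⟨
  Σrhs m    ∎
  where
  open ≡.≡-Reasoning
  L = suc m
  h = proj₁ (odd-part m)
  s⁺ = partialSum (rhsTerm ∘ +_) L m
  s⁻ = partialSum (rhsTerm ∘ -[1+_]) L m
  L≤γ : L ℕ.≤ γ L
  L≤γ = ℕ.≤-trans (ℕ.m≤m+n L (12 ℕ.* L))
    (ℕ.≤-trans (ℕ.m≤n+m (13 ℕ.* L) (12 ℕ.* (L ℕ.* L))) (ℕ.m≤m+n _ 3))

corollary5p8 : Σℕ (λ n → q^ (+ (2 ℕ.* n ℕ.^ 2 ℕ.+ 2 ℕ.* n)) / qPoch (2 ℕ.* n ℕ.+ 1)) lhsTerm-summable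
    ≈ (1# / qPoch∞)
    * Σℤ (λ k → q^ (+ 12 ℤ.* k ℤ.^ 2 ℤ.+ + 5 ℤ.* k) - q^ (+ 12 ℤ.* k ℤ.^ 2 ℤ.- + 13 ℤ.* k ℤ.+ + 3)) rhsTerm-summable
corollary5p8 = begin
  Σlhs                             ≈⟨ S.*-identityʳ Σlhs ⟨
  Σlhs * 1#                        ≈⟨ S.*-congˡ {Σlhs} qPoch∞-inverse ⟨
  Σlhs * (qPoch∞ * qPoch∞ ⁻¹)      ≈⟨ *-assoc Σlhs qPoch∞ (qPoch∞ ⁻¹) ⟨
  Σlhs * qPoch∞ * qPoch∞ ⁻¹        ≈⟨ *-cong Σlhs*qPoch∞ (S.sym (*-identityˡ (qPoch∞ ⁻¹))) ⟩
  Σrhs * (1# / qPoch∞)             ≈⟨ *-comm Σrhs (1# / qPoch∞) ⟩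
  (1# / qPoch∞) * Σrhs             ∎
  where open import Relation.Binary.Reasoning.Setoid S.setoid
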